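{- Let $q\in\mathbb{C}\setminus\{0\}$, let $n\ge 1$ be an integer, and let $P,f\in\mathbb{C}[x^{ -1}][[x]]$ with $P\neq 0$ satisfy $$x\,\sigma_q f+f=P .$$ Then $$L_{n,n}^P\,(f^n)=(-1)^{n(n-1)/2},$$ where $$L_{n,n}^P=\frac{1}{P_n}\left(x\sigma_q+1\right)\frac{1}{P_{n-1}}\left(x^2\sigma_q-1\right)\cdots\frac{1}{P_1}\left(x^n\sigma_q-(-1)^n\right),$$ i.e. $L_{n,n}^P=\frac{1}{P_n}\left(x^{1}\sigma_q-(-1)^{1}\right)\frac{1}{P_{n-1}}\left(x^{2}\sigma_q-(-1)^{2}\right)\cdots\frac{1}{P_1}\left(x^{n}\sigma_q-(-1)^{n}\right)$.
   Context: $\mathbb{C}[x^{ -1}][[x]]$ is the field of formal Laurent series in $x$ with finitely many negative powers. $\sigma_q$ is the automorphism $\sigma_q f(x)=f(qx)$ of this field; $\sigma_q^k=\sigma_{q^k}$. Elements of the field act as multiplication operators, and products of operators denote composition. Define the sequence $P_0=0$, $P_1=P$, and $P_m=\sum_{k=0}^{m-1}(-x\sigma_q)^kP$ for $m\ge 2$ (so $(-x\sigma_q)^kP=(-x)^kq^{k(k-1)/2}\sigma_q^kP$). These $P_m$ ($m\ge1$) are nonzero, so the operator above is well defined. -}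

module Defs where

open import Level using (0ℓ)
open import Algebra.Bundles using (CommutativeRing; RawRing)
import Algebra.Definitions.RawSemiring as RawSemiringDefinitions
import Algebra.Properties.Ring as RingProperties
import Algebra.Solver.Ring.NaturalCoefficients.Default as SemiringSolver
open import Axiom.ExcludedMiddle using (ExcludedMiddle)
open import Data.Fin.Base using (Fin; toℕ)
open import Data.Integer.Base as ℤ using (ℤ; +_; -[1+_])
import Data.Integer.Properties as ℤ
open import Data.List.Base using (foldr; applyUpTo)
open import Data.Nat.Base as ℕ using (ℕ; zero; suc; _∸_)
import Data.Nat.Properties as ℕ
open import Data.Product.Base using (_×_; _,_; ∃; proj₁; proj₂)
open import Data.Rational.Base as ℚ using (ℚ; 0ℚ; 1ℚ; ½; ∣_∣; positive)
import Data.Rational.Properties as ℚ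
open import Data.Rational.Solver using (module +-*-Solver)
import Function.Endo.Propositional as Endomap
open import Function.Base using (_∘′_; id)
open import Relation.Binary.PropositionalEquality
  using (_≡_; refl; sym; trans; cong; subst)
open import Relation.Nullary using (yes; no; does; contradiction)
open import Data.Bool.Base using (if_then_else_)

-- A real is a Cauchy sequence of rationals; _≈ℝ_ says that the difference
-- of two sequences tends to 0.

record ℝ : Set where
  field
    seq    : ℕ → ℚ
    cauchy : ∀ ε → 0ℚ ℚ.< ε →
             ∃ λ N → ∀ m n → N ℕ.≤ m → N ℕ.≤ n → ∣ seq m ℚ.- seq n ∣ ℚ.< ε

open ℝ public

infix 4 _≈ℝ_

_≈ℝ_ : ℝ → ℝ → Set
x ≈ℝ y = ∀ ε → 0ℚ ℚ.< ε → ∃ λ N → ∀ n → N ℕ.≤ n → ∣ seq x n ℚ.- seq y n ∣ ℚ.< ε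

module RealLemmas where

  half>0 : ∀ {ε} → 0ℚ ℚ.< ε → 0ℚ ℚ.< ½ ℚ.* ε
  half>0 {ε} ε>0 = ℚ.positive⁻¹ (½ ℚ.* ε)
    {{ℚ.pos*pos⇒pos ½ ε {{positive ε>0}}}}

  halves : ∀ ε → ½ ℚ.* ε ℚ.+ ½ ℚ.* ε ≡ ε
  halves ε = trans (sym (ℚ.*-distribʳ-+ ε ½ ½)) (ℚ.*-identityˡ ε)

  +-small : ∀ {ε} a b → ∣ a ∣ ℚ.< ½ ℚ.* ε → ∣ b ∣ ℚ.< ½ ℚ.* ε → ∣ a ℚ.+ b ∣ ℚ.< ε
  +-small {ε} a b a< b< =
    ℚ.≤-<-trans (ℚ.∣p+q∣≤∣p∣+∣q∣ a b)
      (subst (∣ a ∣ ℚ.+ ∣ b ∣ ℚ.<_) (halves ε) (ℚ.+-mono-< a< b<))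

  EventuallyBounded : ℝ → ℚ → Set
  EventuallyBounded x B = ∃ λ N → ∀ n → N ℕ.≤ n → ∣ seq x n ∣ ℚ.≤ B

  bounded : ∀ x → ∃ λ B → 0ℚ ℚ.< B × EventuallyBounded x B
  bounded x = let N , close = cauchy x 1ℚ (ℚ.positive⁻¹ 1ℚ)
                  s = seq x
              in 1ℚ ℚ.+ ∣ s N ∣
               , ℚ.+-mono-<-≤ (ℚ.positive⁻¹ 1ℚ) (ℚ.0≤∣p∣ (s N))
               , N , λ n N≤n → begin
                   ∣ s n ∣                         ≡⟨ cong ∣_∣ (split (s n) (s N)) ⟩
                   ∣ (s n ℚ.- s N) ℚ.+ s N ∣       ≤⟨ ℚ.∣p+q∣≤∣p∣+∣q∣ (s n ℚ.- s N) (s N) ⟩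
                   ∣ s n ℚ.- s N ∣ ℚ.+ ∣ s N ∣     ≤⟨ ℚ.+-monoˡ-≤ ∣ s N ∣
                                                      (ℚ.<⇒≤ (close n N N≤n ℕ.≤-refl)) ⟩
                   1ℚ ℚ.+ ∣ s N ∣                  ∎
    where
    open ℚ.≤-Reasoning
    open +-*-Solver
    split : ∀ a b → a ≡ (a ℚ.- b) ℚ.+ b
    split = solve 2 (λ a b → a := (a :- b) :+ b) refl

  common-bound : ∀ x y → ∃ λ B → 0ℚ ℚ.< B × EventuallyBounded x B × EventuallyBounded y B
  common-bound x y =
    let B , B>0 , M , x≤ = bounded x
        C , C>0 , N , y≤ = bounded y
    in B ℚ.+ C
     , ℚ.+-mono-< B>0 C>0
     , (M , λ n M≤n → ℚ.≤-trans (x≤ n M≤n)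
          (subst (ℚ._≤ B ℚ.+ C) (ℚ.+-identityʳ B) (ℚ.+-monoʳ-≤ B (ℚ.<⇒≤ C>0))))
     , (N , λ n N≤n → ℚ.≤-trans (y≤ n N≤n)
          (subst (ℚ._≤ B ℚ.+ C) (ℚ.+-identityˡ C) (ℚ.+-monoˡ-≤ C (ℚ.<⇒≤ B>0))))

  module _ {B ε : ℚ} (B>0 : 0ℚ ℚ.< B) (ε>0 : 0ℚ ℚ.< ε) where

    private instance
      B-pos  = positive B>0
      B-nz   = ℚ.pos⇒nonZero B
      B⁻-pos = ℚ.1/pos⇒pos B
      ε-pos  = positive ε>0

    scaled : ℚ
    scaled = ℚ.1/ B ℚ.* (½ ℚ.* ε)

    scaled>0 : 0ℚ ℚ.< scaled
    scaled>0 = ℚ.positive⁻¹ scaled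
      {{ℚ.pos*pos⇒pos (ℚ.1/ B) (½ ℚ.* ε) {{ℚ.pos*pos⇒pos ½ ε}}}}

    private
      unscale : B ℚ.* scaled ≡ ½ ℚ.* ε
      unscale = trans (sym (ℚ.*-assoc B (ℚ.1/ B) (½ ℚ.* ε)))
        (trans (cong (ℚ._* (½ ℚ.* ε)) (ℚ.*-inverseʳ B)) (ℚ.*-identityˡ _))

      *-bound : ∀ a b → ∣ a ∣ ℚ.≤ B → ∣ b ∣ ℚ.< scaled → ∣ a ℚ.* b ∣ ℚ.< ½ ℚ.* ε
      *-bound a b a≤ b< = begin-strict
        ∣ a ℚ.* b ∣       ≡⟨ ℚ.∣p*q∣≡∣p∣*∣q∣ a b ⟩
        ∣ a ∣ ℚ.* ∣ b ∣   ≤⟨ ℚ.*-monoʳ-≤-nonNeg ∣ b ∣ {{ℚ.∣-∣-nonNeg b}} a≤ ⟩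
        B ℚ.* ∣ b ∣       <⟨ ℚ.*-monoʳ-<-pos B b< ⟩
        B ℚ.* scaled      ≡⟨ unscale ⟩
        ½ ℚ.* ε           ∎
        where open ℚ.≤-Reasoning

    *-close : ∀ a b c d → ∣ a ∣ ℚ.≤ B → ∣ d ∣ ℚ.≤ B →
              ∣ a ℚ.- c ∣ ℚ.< scaled → ∣ b ℚ.- d ∣ ℚ.< scaled →
              ∣ a ℚ.* b ℚ.- c ℚ.* d ∣ ℚ.< ε
    *-close a b c d a≤ d≤ ac< bd< =
      subst (λ z → ∣ z ∣ ℚ.< ε) (split a b c d)
        (+-small (a ℚ.* (b ℚ.- d)) (d ℚ.* (a ℚ.- c))
          (*-bound a (b ℚ.- d) a≤ bd<) (*-bound d (a ℚ.- c) d≤ ac<))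
      where
      open +-*-Solver
      split : ∀ a b c d → a ℚ.* (b ℚ.- d) ℚ.+ d ℚ.* (a ℚ.- c) ≡ a ℚ.* b ℚ.- c ℚ.* d
      split = solve 4 (λ a b c d → a :* (b :- d) :+ d :* (a :- c) := a :* b :- c :* d) refl

  +-interchange : ∀ a b c d → (a ℚ.- c) ℚ.+ (b ℚ.- d) ≡ (a ℚ.+ b) ℚ.- (c ℚ.+ d)
  +-interchange = solve 4 (λ a b c d → (a :- c) :+ (b :- d) := (a :+ b) :- (c :+ d)) refl
    where open +-*-Solver

  ∣∣-swap : ∀ a b → ∣ a ℚ.- b ∣ ≡ ∣ b ℚ.- a ∣
  ∣∣-swap a b = trans (sym (ℚ.∣-p∣≡∣p∣ (a ℚ.- b))) (cong ∣_∣ (flip- a b))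
    where
    open +-*-Solver
    flip- : ∀ a b → ℚ.- (a ℚ.- b) ≡ b ℚ.- a
    flip- = solve 2 (λ a b → :- (a :- b) := b :- a) refl

  ∣∣-neg : ∀ a b → ∣ a ℚ.- b ∣ ≡ ∣ ℚ.- a ℚ.- ℚ.- b ∣
  ∣∣-neg a b = trans (sym (ℚ.∣-p∣≡∣p∣ (a ℚ.- b))) (cong ∣_∣ (ℚ.neg-distrib-+ a (ℚ.- b)))

  ∣∣-self : ∀ {a b ε} → a ≡ b → 0ℚ ℚ.< ε → ∣ a ℚ.- b ∣ ℚ.< ε
  ∣∣-self {a} refl ε>0 = subst (λ z → ∣ z ∣ ℚ.< _) (sym (ℚ.+-inverseʳ a)) ε>0

  pointwise : ∀ {x y} → (∀ n → seq x n ≡ seq y n) → x ≈ℝ y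
  pointwise eq ε ε>0 = 0 , λ n _ → ∣∣-self (eq n) ε>0

open RealLemmas

fromℚ : ℚ → ℝ
fromℚ p = record { seq = λ _ → p ; cauchy = λ ε ε>0 → 0 , λ _ _ _ _ → ∣∣-self {p} refl ε>0 }

infixl 6 _+ℝ_
infixl 7 _*ℝ_
infix  8 -ℝ_

_+ℝ_ _*ℝ_ : ℝ → ℝ → ℝ
x +ℝ y = record
  { seq    = λ n → seq x n ℚ.+ seq y n
  ; cauchy = λ ε ε>0 →
      let M , x~ = cauchy x (½ ℚ.* ε) (half>0 ε>0)
          N , y~ = cauchy y (½ ℚ.* ε) (half>0 ε>0)
      in M ℕ.⊔ N , λ m n m≥ n≥ →
         subst (λ z → ∣ z ∣ ℚ.< ε) (+-interchange (seq x m) (seq y m) (seq x n) (seq y n))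
           (+-small (seq x m ℚ.- seq x n) (seq y m ℚ.- seq y n)
             (x~ m n (ℕ.m⊔n≤o⇒m≤o M N m≥) (ℕ.m⊔n≤o⇒m≤o M N n≥))
             (y~ m n (ℕ.m⊔n≤o⇒n≤o M N m≥) (ℕ.m⊔n≤o⇒n≤o M N n≥)))
  }
x *ℝ y = record
  { seq    = λ n → seq x n ℚ.* seq y n
  ; cauchy = λ ε ε>0 →
      let B , B>0 , (K , x≤) , (L , y≤) = common-bound x y
          M , x~ = cauchy x (scaled B>0 ε>0) (scaled>0 B>0 ε>0)
          N , y~ = cauchy y (scaled B>0 ε>0) (scaled>0 B>0 ε>0)
      in (K ℕ.⊔ L) ℕ.⊔ (M ℕ.⊔ N) , λ m n m≥ n≥ →
         let m≥KL = ℕ.m⊔n≤o⇒m≤o (K ℕ.⊔ L) (M ℕ.⊔ N) m≥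
             m≥MN = ℕ.m⊔n≤o⇒n≤o (K ℕ.⊔ L) (M ℕ.⊔ N) m≥
             n≥KL = ℕ.m⊔n≤o⇒m≤o (K ℕ.⊔ L) (M ℕ.⊔ N) n≥
             n≥MN = ℕ.m⊔n≤o⇒n≤o (K ℕ.⊔ L) (M ℕ.⊔ N) n≥
         in *-close B>0 ε>0 (seq x m) (seq y m) (seq x n) (seq y n)
              (x≤ m (ℕ.m⊔n≤o⇒m≤o K L m≥KL)) (y≤ n (ℕ.m⊔n≤o⇒n≤o K L n≥KL))
              (x~ m n (ℕ.m⊔n≤o⇒m≤o M N m≥MN) (ℕ.m⊔n≤o⇒m≤o M N n≥MN))
              (y~ m n (ℕ.m⊔n≤o⇒n≤o M N m≥MN) (ℕ.m⊔n≤o⇒n≤o M N n≥MN))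
  }

-ℝ_ : ℝ → ℝ
-ℝ x = record
  { seq    = λ n → ℚ.- seq x n
  ; cauchy = λ ε ε>0 → let N , x~ = cauchy x ε ε>0 in
      N , λ m n m≥ n≥ → subst (ℚ._< ε) (∣∣-neg (seq x m) (seq x n)) (x~ m n m≥ n≥)
  }

module RealCongruence where

  ≈-refl : ∀ {x} → x ≈ℝ x
  ≈-refl {x} = pointwise {x} {x} (λ _ → refl)

  ≈-sym : ∀ {x y} → x ≈ℝ y → y ≈ℝ x
  ≈-sym {x} {y} x≈y ε ε>0 = let N , x~y = x≈y ε ε>0 in
    N , λ n n≥ → subst (ℚ._< ε) (∣∣-swap (seq x n) (seq y n)) (x~y n n≥)

  ≈-trans : ∀ {x y z} → x ≈ℝ y → y ≈ℝ z → x ≈ℝ z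
  ≈-trans {x} {y} {z} x≈y y≈z ε ε>0 =
    let M , x~y = x≈y (½ ℚ.* ε) (half>0 ε>0)
        N , y~z = y≈z (½ ℚ.* ε) (half>0 ε>0)
    in M ℕ.⊔ N , λ n n≥ →
       subst (λ w → ∣ w ∣ ℚ.< ε) (telescope (seq x n) (seq y n) (seq z n))
         (+-small (seq x n ℚ.- seq y n) (seq y n ℚ.- seq z n)
           (x~y n (ℕ.m⊔n≤o⇒m≤o M N n≥)) (y~z n (ℕ.m⊔n≤o⇒n≤o M N n≥)))
    where
    open +-*-Solver
    telescope : ∀ a b c → (a ℚ.- b) ℚ.+ (b ℚ.- c) ≡ a ℚ.- c
    telescope = solve 3 (λ a b c → (a :- b) :+ (b :- c) := a :- c) refl

  +-cong : ∀ {x x′ y y′} → x ≈ℝ x′ → y ≈ℝ y′ → (x +ℝ y) ≈ℝ (x′ +ℝ y′)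
  +-cong {x} {x′} {y} {y′} x≈ y≈ ε ε>0 =
    let M , x~ = x≈ (½ ℚ.* ε) (half>0 ε>0)
        N , y~ = y≈ (½ ℚ.* ε) (half>0 ε>0)
    in M ℕ.⊔ N , λ n n≥ →
       subst (λ z → ∣ z ∣ ℚ.< ε) (+-interchange (seq x n) (seq y n) (seq x′ n) (seq y′ n))
         (+-small (seq x n ℚ.- seq x′ n) (seq y n ℚ.- seq y′ n)
           (x~ n (ℕ.m⊔n≤o⇒m≤o M N n≥)) (y~ n (ℕ.m⊔n≤o⇒n≤o M N n≥)))

  *-cong : ∀ {x x′ y y′} → x ≈ℝ x′ → y ≈ℝ y′ → (x *ℝ y) ≈ℝ (x′ *ℝ y′)
  *-cong {x} {x′} {y} {y′} x≈ y≈ ε ε>0 =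
    let B , B>0 , (K , x≤) , (L , y≤) = common-bound x y′
        M , x~ = x≈ (scaled B>0 ε>0) (scaled>0 B>0 ε>0)
        N , y~ = y≈ (scaled B>0 ε>0) (scaled>0 B>0 ε>0)
    in (K ℕ.⊔ L) ℕ.⊔ (M ℕ.⊔ N) , λ n n≥ →
       let n≥KL = ℕ.m⊔n≤o⇒m≤o (K ℕ.⊔ L) (M ℕ.⊔ N) n≥
           n≥MN = ℕ.m⊔n≤o⇒n≤o (K ℕ.⊔ L) (M ℕ.⊔ N) n≥
       in *-close B>0 ε>0 (seq x n) (seq y n) (seq x′ n) (seq y′ n)
            (x≤ n (ℕ.m⊔n≤o⇒m≤o K L n≥KL)) (y≤ n (ℕ.m⊔n≤o⇒n≤o K L n≥KL))
            (x~ n (ℕ.m⊔n≤o⇒m≤o M N n≥MN)) (y~ n (ℕ.m⊔n≤o⇒n≤o M N n≥MN))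

  -‿cong : ∀ {x y} → x ≈ℝ y → (-ℝ x) ≈ℝ (-ℝ y)
  -‿cong {x} {y} x≈y ε ε>0 = let N , x~y = x≈y ε ε>0 in
    N , λ n n≥ → subst (ℚ._< ε) (∣∣-neg (seq x n) (seq y n)) (x~y n n≥)

ℝ-commutativeRing : CommutativeRing 0ℓ 0ℓ
ℝ-commutativeRing = record
  { Carrier = ℝ ; _≈_ = _≈ℝ_ ; _+_ = _+ℝ_ ; _*_ = _*ℝ_ ; -_ = -ℝ_
  ; 0# = fromℚ 0ℚ ; 1# = fromℚ 1ℚ
  ; isCommutativeRing = record
    { isRing = record
      { +-isAbelianGroup = record
        { isGroup = record
          { isMonoid = record
            { isSemigroup = record
              { isMagma = record
                { isEquivalence = record
                  { refl  = λ {x} → ≈-refl {x}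
                  ; sym   = λ {x} {y} → ≈-sym {x} {y}
                  ; trans = λ {x} {y} {z} → ≈-trans {x} {y} {z}
                  }
                ; ∙-cong = λ {x} {x′} {y} {y′} → +-cong {x} {x′} {y} {y′}
                }
              ; assoc = λ x y z → pointwise {x +ℝ y +ℝ z} {x +ℝ (y +ℝ z)}
                          λ n → ℚ.+-assoc (seq x n) (seq y n) (seq z n)
              }
            ; identity = (λ x → pointwise {fromℚ 0ℚ +ℝ x} {x} λ n → ℚ.+-identityˡ (seq x n))
                       , (λ x → pointwise {x +ℝ fromℚ 0ℚ} {x} λ n → ℚ.+-identityʳ (seq x n))
            }
          ; inverse = (λ x → pointwise { -ℝ x +ℝ x} {fromℚ 0ℚ} λ n → ℚ.+-inverseˡ (seq x n))
                    , (λ x → pointwise {x +ℝ -ℝ x} {fromℚ 0ℚ} λ n → ℚ.+-inverseʳ (seq x n))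
          ; ⁻¹-cong = λ {x} {y} → -‿cong {x} {y}
          }
        ; comm = λ x y → pointwise {x +ℝ y} {y +ℝ x} λ n → ℚ.+-comm (seq x n) (seq y n)
        }
      ; *-cong = λ {x} {x′} {y} {y′} → *-cong {x} {x′} {y} {y′}
      ; *-assoc = λ x y z → pointwise {x *ℝ y *ℝ z} {x *ℝ (y *ℝ z)}
                    λ n → ℚ.*-assoc (seq x n) (seq y n) (seq z n)
      ; *-identity = (λ x → pointwise {fromℚ 1ℚ *ℝ x} {x} λ n → ℚ.*-identityˡ (seq x n))
                   , (λ x → pointwise {x *ℝ fromℚ 1ℚ} {x} λ n → ℚ.*-identityʳ (seq x n))
      ; distrib = (λ x y z → pointwise {x *ℝ (y +ℝ z)} {x *ℝ y +ℝ x *ℝ z}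
                     λ n → ℚ.*-distribˡ-+ (seq x n) (seq y n) (seq z n))
                , (λ x y z → pointwise {(y +ℝ z) *ℝ x} {y *ℝ x +ℝ z *ℝ x}
                     λ n → ℚ.*-distribʳ-+ (seq x n) (seq y n) (seq z n))
      }
    ; *-comm = λ x y → pointwise {x *ℝ y} {y *ℝ x} λ n → ℚ.*-comm (seq x n) (seq y n)
    }
  }
  where open RealCongruence

-- (a , b) stands for a + b i with i² = −1.
module AdjoinI (R : CommutativeRing 0ℓ 0ℓ) where

  open CommutativeRing R hiding (refl; sym; trans) renaming (Carrier to A)
  private module ≈ = CommutativeRing R using (refl; sym; trans)
  open RingProperties ring using (-1*x≈-x)
  open SemiringSolver commutativeSemiring using (solve; _:+_; _:*_; _:=_; con)
  open import Relation.Binary.Reasoning.Setoid setoid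

  infixl 6 _+ᶜ_
  infixl 7 _*ᶜ_

  _+ᶜ_ _*ᶜ_ : A × A → A × A → A × A
  (a , b) +ᶜ (c , d) = a + c , b + d
  (a , b) *ᶜ (c , d) = a * c - b * d , a * d + b * c

  private
    _≈ᶜ_ : A × A → A × A → Set
    (a , b) ≈ᶜ (c , d) = (a ≈ c) × (b ≈ d)

    j : A
    j = - 1#

    ⊖ : ∀ u v → u - v ≈ u + j * v
    ⊖ u v = +-congˡ (≈.sym (-1*x≈-x v))

    assocᶜ : ∀ x y z → ((x *ᶜ y) *ᶜ z) ≈ᶜ (x *ᶜ (y *ᶜ z))
    assocᶜ (a , b) (c , d) (e , f) =
      (begin
        (a * c - b * d) * e - (a * d + b * c) * f
          ≈⟨ ⊖ _ _ ⟩
        (a * c - b * d) * e + j * ((a * d + b * c) * f)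
          ≈⟨ +-congʳ (*-congʳ (⊖ _ _)) ⟩
        (a * c + j * (b * d)) * e + j * ((a * d + b * c) * f)
          ≈⟨ solve 7 (λ a b c d e f j →
               (a :* c :+ j :* (b :* d)) :* e :+ j :* ((a :* d :+ b :* c) :* f)
               := a :* (c :* e :+ j :* (d :* f)) :+ j :* (b :* (c :* f :+ d :* e)))
               ≈.refl a b c d e f j ⟩
        a * (c * e + j * (d * f)) + j * (b * (c * f + d * e))
          ≈⟨ +-congʳ (*-congˡ (⊖ _ _)) ⟨
        a * (c * e - d * f) + j * (b * (c * f + d * e))
          ≈⟨ ⊖ _ _ ⟨
        a * (c * e - d * f) - b * (c * f + d * e) ∎)
      ,
      (begin
        (a * c - b * d) * f + (a * d + b * c) * e
          ≈⟨ +-congʳ (*-congʳ (⊖ _ _)) ⟩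
        (a * c + j * (b * d)) * f + (a * d + b * c) * e
          ≈⟨ solve 7 (λ a b c d e f j →
               (a :* c :+ j :* (b :* d)) :* f :+ (a :* d :+ b :* c) :* e
               := a :* (c :* f :+ d :* e) :+ b :* (c :* e :+ j :* (d :* f)))
               ≈.refl a b c d e f j ⟩
        a * (c * f + d * e) + b * (c * e + j * (d * f))
          ≈⟨ +-congˡ (*-congˡ (⊖ _ _)) ⟨
        a * (c * f + d * e) + b * (c * e - d * f) ∎)

    commᶜ : ∀ x y → (x *ᶜ y) ≈ᶜ (y *ᶜ x)
    commᶜ (a , b) (c , d) =
        +-cong (*-comm a c) (-‿cong (*-comm b d))
      , ≈.trans (+-comm (a * d) (b * c)) (+-cong (*-comm b c) (*-comm a d))

    identityˡᶜ : ∀ x → ((1# , 0#) *ᶜ x) ≈ᶜ x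
    identityˡᶜ (a , b) =
        ≈.trans (⊖ _ _) (solve 3 (λ a b j → con 1 :* a :+ j :* (con 0 :* b) := a) ≈.refl a b j)
      , solve 2 (λ a b → con 1 :* b :+ con 0 :* a := b) ≈.refl a b

    distribˡᶜ : ∀ x y z → (x *ᶜ (y +ᶜ z)) ≈ᶜ ((x *ᶜ y) +ᶜ (x *ᶜ z))
    distribˡᶜ (a , b) (c , d) (e , f) =
      (begin
        a * (c + e) - b * (d + f)
          ≈⟨ ⊖ _ _ ⟩
        a * (c + e) + j * (b * (d + f))
          ≈⟨ solve 7 (λ a b c d e f j →
               a :* (c :+ e) :+ j :* (b :* (d :+ f))
               := (a :* c :+ j :* (b :* d)) :+ (a :* e :+ j :* (b :* f)))
               ≈.refl a b c d e f j ⟩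
        (a * c + j * (b * d)) + (a * e + j * (b * f))
          ≈⟨ +-cong (⊖ _ _) (⊖ _ _) ⟨
        (a * c - b * d) + (a * e - b * f) ∎)
      ,
      solve 6 (λ a b c d e f →
        a :* (d :+ f) :+ b :* (c :+ e) := (a :* d :+ b :* c) :+ (a :* f :+ b :* e))
        ≈.refl a b c d e f

    congᶜ : ∀ {x x′ y y′} → x ≈ᶜ x′ → y ≈ᶜ y′ → (x *ᶜ y) ≈ᶜ (x′ *ᶜ y′)
    congᶜ (p , q) (r , s) =
      +-cong (*-cong p r) (-‿cong (*-cong q s)) , +-cong (*-cong p s) (*-cong q r)

    transᶜ : ∀ {x y z} → x ≈ᶜ y → y ≈ᶜ z → x ≈ᶜ z
    transᶜ (p , q) (r , s) = ≈.trans p r , ≈.trans q s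

  commutativeRing : CommutativeRing 0ℓ 0ℓ
  commutativeRing = record
    { Carrier = A × A
    ; _≈_ = λ { (a , b) (c , d) → (a ≈ c) × (b ≈ d) }
    ; _+_ = _+ᶜ_ ; _*_ = _*ᶜ_ ; -_ = λ { (a , b) → - a , - b }
    ; 0# = 0# , 0# ; 1# = 1# , 0#
    ; isCommutativeRing = record
      { isRing = record
        { +-isAbelianGroup = record
          { isGroup = record
            { isMonoid = record
              { isSemigroup = record
                { isMagma = record
                  { isEquivalence = record
                    { refl  = ≈.refl , ≈.refl
                    ; sym   = λ { (p , q) → ≈.sym p , ≈.sym q }
                    ; trans = transᶜ
                    }
                  ; ∙-cong = λ { (p , q) (r , s) → +-cong p r , +-cong q s }
                  }
                ; assoc = λ { (a , b) (c , d) (e , f) → +-assoc a c e , +-assoc b d f }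
                }
              ; identity = (λ { (a , b) → +-identityˡ a , +-identityˡ b })
                         , (λ { (a , b) → +-identityʳ a , +-identityʳ b })
              }
            ; inverse = (λ { (a , b) → -‿inverseˡ a , -‿inverseˡ b })
                      , (λ { (a , b) → -‿inverseʳ a , -‿inverseʳ b })
            ; ⁻¹-cong = λ { (p , q) → -‿cong p , -‿cong q }
            }
          ; comm = λ { (a , b) (c , d) → +-comm a c , +-comm b d }
          }
        ; *-cong = congᶜ
        ; *-assoc = assocᶜ
        ; *-identity = identityˡᶜ , λ x → transᶜ (commᶜ x (1# , 0#)) (identityˡᶜ x)
        ; distrib = distribˡᶜ
                  , λ x y z → transᶜ (commᶜ (y +ᶜ z) x)
                      (transᶜ (distribˡᶜ x y z)
                        (+-cong (proj₁ (commᶜ x y)) (proj₁ (commᶜ x z))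
                        , +-cong (proj₂ (commᶜ x y)) (proj₂ (commᶜ x z))))
        }
      ; *-comm = commᶜ
      }
    }

ℂ-commutativeRing : CommutativeRing 0ℓ 0ℓ
ℂ-commutativeRing = AdjoinI.commutativeRing ℝ-commutativeRing

open CommutativeRing ℂ-commutativeRing public
  using () renaming (Carrier to ℂ; _≈_ to _≈ℂ_; 0# to 0ℂ)

-- Total inversion: elements with no inverse are sent to 0#. It is used at ℂ
-- and at Laurent series over ℂ, which are classically fields, so there the
-- fallback only concerns 0#; inverses are unique up to _≈_.
module Reciprocal (em : ExcludedMiddle 0ℓ) (R : RawRing 0ℓ 0ℓ) where

  open RawRing R

  infix 8 _⁻¹

  _⁻¹ : Carrier → Carrier
  a ⁻¹ with em {∃ λ b → a * b ≈ 1#}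
  ... | yes (b , _) = b
  ... | no  _       = 0#

module LaurentSeries (K : CommutativeRing 0ℓ 0ℓ) where

  open CommutativeRing K hiding (refl; sym; trans)
  private module ≈ = CommutativeRing K using (refl; trans)
  open RingProperties ring using (-0#≈0#)
  open RawSemiringDefinitions (RawRing.rawSemiring rawRing) using (sum)

  -- `order` is a lower bound for the exponents that occur; the
  -- coefficient at that exponent may vanish.
  record Laurent : Set where
    field
      coeff  : ℤ → Carrier
      order  : ℤ
      vanish : ∀ k → k ℤ.< order → coeff k ≈ 0#

  open Laurent public

  infix 4 _≈ᴸ_

  _≈ᴸ_ : Laurent → Laurent → Set
  f ≈ᴸ g = ∀ k → coeff f k ≈ coeff g k

  monomial : ℤ → Carrier → Laurent
  monomial k c = record
    { coeff  = λ i → if does (i ℤ.≟ k) then c else 0#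
    ; order  = k
    ; vanish = van
    }
    where
    van : ∀ i → i ℤ.< k → (if does (i ℤ.≟ k) then c else 0#) ≈ 0#
    van i i<k with i ℤ.≟ k
    ... | yes i≡k = contradiction i≡k (ℤ.<⇒≢ i<k)
    ... | no  _   = ≈.refl

  x : Laurent
  x = monomial (+ 1) 1#

  infixl 6 _+ᴸ_
  infixl 7 _*ᴸ_
  infix  8 -ᴸ_

  _+ᴸ_ : Laurent → Laurent → Laurent
  f +ᴸ g = record
    { coeff  = λ k → coeff f k + coeff g k
    ; order  = order f ℤ.⊓ order g
    ; vanish = λ k k< → ≈.trans
        (+-cong (vanish f k (ℤ.<-≤-trans k< (ℤ.i⊓j≤i (order f) (order g))))
                (vanish g k (ℤ.<-≤-trans k< (ℤ.i⊓j≤j (order f) (order g)))))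
        (+-identityˡ 0#)
    }

  -ᴸ_ : Laurent → Laurent
  -ᴸ f = record
    { coeff  = λ k → - coeff f k
    ; order  = order f
    ; vanish = λ k k< → ≈.trans (-‿cong (vanish f k k<)) -0#≈0#
    }

  #[0⋯_] : ℤ → ℕ
  #[0⋯ + n ]      = suc n
  #[0⋯ -[1+ _ ] ] = 0

  -- (f g)ₖ is the sum of fᵢ gₖ₋ᵢ over order f ≤ i ≤ k − order g.
  _*ᴸ_ : Laurent → Laurent → Laurent
  f *ᴸ g = record
    { coeff  = λ k → sum (term k {#[0⋯ k ℤ.- (order f ℤ.+ order g) ]})
    ; order  = order f ℤ.+ order g
    ; vanish = van
    }
    where
    term : ℤ → ∀ {m} → Fin m → Carrier
    term k j = let i = order f ℤ.+ + toℕ j in coeff f i * coeff g (k ℤ.- i)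

    van : ∀ k → k ℤ.< order f ℤ.+ order g →
          sum (term k {#[0⋯ k ℤ.- (order f ℤ.+ order g) ]}) ≈ 0#
    van k k< with k ℤ.- (order f ℤ.+ order g) in eq
    ... | -[1+ _ ] = ≈.refl
    ... | + n      = contradiction k<
            (ℤ.≤⇒≯ (ℤ.0≤i-j⇒j≤i (subst (ℤ.0ℤ ℤ.≤_) (sym eq) (ℤ.+≤+ ℕ.z≤n))))

  0ᴸ 1ᴸ : Laurent
  0ᴸ = monomial (+ 0) 0#
  1ᴸ = monomial (+ 0) 1#

  laurentRawRing : RawRing 0ℓ 0ℓ
  laurentRawRing = record
    { Carrier = Laurent ; _≈_ = _≈ᴸ_ ; _+_ = _+ᴸ_ ; _*_ = _*ᴸ_ ; -_ = -ᴸ_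
    ; 0# = 0ᴸ ; 1# = 1ᴸ
    }

  open RawSemiringDefinitions (RawRing.rawSemiring laurentRawRing) public
    using () renaming (_^_ to _^ᴸ_; sum to sumᴸ)

module QDifference (em : ExcludedMiddle 0ℓ) (K : CommutativeRing 0ℓ 0ℓ)
                   (q : CommutativeRing.Carrier K) where

  open LaurentSeries K
  private
    module K where
      open CommutativeRing K public
      open RawSemiringDefinitions (RawRing.rawSemiring rawRing) public using (_^_)
      open Reciprocal em rawRing public
  open Reciprocal em laurentRawRing using (_⁻¹)
  open Endomap Laurent using (Endo) renaming (_^_ to _^∘_)

  infix 9 q^_

  q^_ : ℤ → K.Carrier
  q^ (+ n)    = q K.^ n
  q^ -[1+ n ] = (q K.⁻¹) K.^ suc n

  σ : Endo
  σ f = record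
    { coeff  = λ k → q^ k K.* coeff f k
    ; order  = order f
    ; vanish = λ k k< → K.trans (K.*-congˡ (vanish f k k<)) (K.zeroʳ _)
    }

  -xσ : Endo
  -xσ f = (-ᴸ x) *ᴸ σ f

  -- The empty sum gives P₀ = 0; the sum with one term gives P₁ = P.
  P[_] : Laurent → ℕ → Laurent
  P[ P ] m = sumᴸ {m} λ k → (-xσ ^∘ toℕ k) P

  xʲσ-[-1]ʲ : ℕ → Endo
  xʲσ-[-1]ʲ j f = (x ^ᴸ j) *ᴸ σ f +ᴸ -ᴸ (((-ᴸ 1ᴸ) ^ᴸ j) *ᴸ f)

  -- Leftmost factor first: the factor with index i (0 ≤ i < n) is
  -- (1 / Pₙ₋ᵢ) (xⁱ⁺¹ σ − (−1)ⁱ⁺¹).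
  L : Laurent → ℕ → Endo
  L P n = foldr _∘′_ id
    (applyUpTo (λ i → ((P[ P ] (n ∸ i)) ⁻¹ *ᴸ_) ∘′ xʲσ-[-1]ʲ (suc i)) n)

open LaurentSeries ℂ-commutativeRing public
  using (Laurent; x; _≈ᴸ_; _+ᴸ_; _*ᴸ_; -ᴸ_; 0ᴸ; 1ᴸ; _^ᴸ_)

σ : (em : ExcludedMiddle 0ℓ) → ℂ → Laurent → Laurent
σ em q = QDifference.σ em ℂ-commutativeRing q

-- L^P_{n,n}
L : (em : ExcludedMiddle 0ℓ) → ℂ → Laurent → ℕ → Laurent → Laurent
L em q = QDifference.L em ℂ-commutativeRing q

{-# OPTIONS --safe #-}
module Submission where

-- Put T = −xσ and sₖ = Tᵏf. The equation says Tf = f − P, so sₖ = f − Pₖ by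
-- iteration. T is σ-semilinear, hence on an integral form h of degree j in the sᵢ
-- the operator xʲσ − (−1)ʲ acts as (−1)ʲ times the difference between h with all
-- indices raised by one and h. For the complete homogeneous polynomials
--   hⱼ(s₁,…,sᵣ) − hⱼ(s₀,…,sᵣ₋₁) = (sᵣ − s₀) hⱼ₋₁(s₀,…,sᵣ)  and  sᵣ − s₀ = −Pᵣ,
-- so starting from fⁿ = hₙ(s₀) each factor of L lowers the degree by one, adds a
-- variable and multiplies by a sign, and after n factors only h₀ = 1 is left.
-- The divisions by Pₘ are legitimate because Pₘ has the leading term of P.

open import Defs using
  ( ℝ; seq; cauchy; _≈ℝ_; _+ℝ_; _*ℝ_; fromℚ; module RealLemmas
  ; ℝ-commutativeRing; ℂ-commutativeRing
  ; module AdjoinI; module LaurentSeries; module QDifference; module Reciprocal)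
open import Level using (0ℓ)
open import Algebra.Bundles using (CommutativeRing; RawRing)
import Algebra.Definitions.RawSemiring as RawSemiringDefinitions
open import Algebra.Morphism.Structures using (IsRingHomomorphism)
import Algebra.Properties.CommutativeSemiring.Exp as Exp
import Algebra.Properties.Ring as RingProperties
import Algebra.Solver.Ring.NaturalCoefficients.Default as SemiringSolver
open import Axiom.ExcludedMiddle using (ExcludedMiddle)
open import Data.Fin.Base as Fin using (Fin; toℕ)
import Data.Fin.Properties as Fin
open import Data.Integer.Base as ℤ using (ℤ; +_; -[1+_]; 0ℤ; 1ℤ)
import Data.Integer.Properties as ℤ
import Data.Integer.Solver as ℤ
open import Data.List.Base using (foldr; applyUpTo)
open import Data.Nat.Base as ℕ using (ℕ; zero; suc; z≤n; s≤s; _∸_; _≤_; _<_)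
open import Data.Nat.DivMod using (_/_; m*n/n≡m)
import Data.Nat.Properties as ℕ
import Data.Nat.Solver as ℕ
open import Data.Product.Base using (_×_; _,_; ∃; proj₁; proj₂)
open import Data.Rational.Base as ℚ using (ℚ; 0ℚ; 1ℚ; ½; ∣_∣; positive)
import Data.Rational.Properties as ℚ
open import Data.Rational.Solver using (module +-*-Solver)
open import Data.Sum.Base using (_⊎_; inj₁; inj₂)
open import Function.Base using (_∘_; _∘′_; id)
import Function.Endo.Propositional as Endomap
import Relation.Binary.PropositionalEquality as ≡
open ≡ using (_≡_)
open import Relation.Binary.Structures using (IsEquivalence)
open import Relation.Nullary using (¬_; yes; no; contradiction)
open import Relation.Nullary.Decidable using (decidable-stable)

-- Convolution of sequences.

module CauchyProduct (K : CommutativeRing 0ℓ 0ℓ) where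

  open CommutativeRing K renaming (Carrier to A)
  open RawSemiringDefinitions (RawRing.rawSemiring rawRing) using (sum)
  open SemiringSolver commutativeSemiring using (solve; _:+_; _:*_; _:=_)
  open import Relation.Binary.Reasoning.Setoid setoid

  infixl 7 _⊛_
  -- Recursion that drops the first term of the left factor turns the ring laws into plain
  -- inductions; `sum-⊛` connects it with the finite sums that define `_*ᴸ_`.
  _⊛_ : (ℕ → A) → (ℕ → A) → ℕ → A
  (f ⊛ g) zero    = f 0 * g 0
  (f ⊛ g) (suc n) = f 0 * g (suc n) + (f ∘ suc ⊛ g) n

  sum-⊛ : ∀ n {f g} (t : Fin (suc n) → A) →
          (∀ j → t j ≈ f (toℕ j) * g (n ∸ toℕ j)) → sum t ≈ (f ⊛ g) n
  sum-⊛ zero    t t≈ = trans (+-identityʳ _) (t≈ Fin.zero)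
  sum-⊛ (suc n) t t≈ = +-cong (t≈ Fin.zero) (sum-⊛ n (t ∘ Fin.suc) (t≈ ∘ Fin.suc))

  -- The bounded form serves the construction of inverse series, where approximations agree only on
  -- an initial segment.
  ⊛-cong-≤ : ∀ n {f f′ g g′} → (∀ {i} → i ≤ n → f i ≈ f′ i) → (∀ {i} → i ≤ n → g i ≈ g′ i) →
             (f ⊛ g) n ≈ (f′ ⊛ g′) n
  ⊛-cong-≤ zero    f≈ g≈ = *-cong (f≈ z≤n) (g≈ z≤n)
  ⊛-cong-≤ (suc n) f≈ g≈ = +-cong (*-cong (f≈ z≤n) (g≈ ℕ.≤-refl))
    (⊛-cong-≤ n (f≈ ∘ s≤s) (g≈ ∘ ℕ.m≤n⇒m≤1+n))

  ⊛-cong : ∀ {f f′ g g′} → (∀ i → f i ≈ f′ i) → (∀ i → g i ≈ g′ i) →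
           ∀ n → (f ⊛ g) n ≈ (f′ ⊛ g′) n
  ⊛-cong f≈ g≈ n = ⊛-cong-≤ n (λ {i} _ → f≈ i) (λ {i} _ → g≈ i)

  -- Peels off the last term where the definition peels off the first. Exchanging the factors
  -- exchanges the two, which gives `⊛-comm`.
  ⊛-sucʳ : ∀ f g n → (f ⊛ g) (suc n) ≈ (f ⊛ g ∘ suc) n + f (suc n) * g 0
  ⊛-sucʳ f g zero    = refl
  ⊛-sucʳ f g (suc n) = trans (+-congˡ (⊛-sucʳ (f ∘ suc) g n)) (sym (+-assoc _ _ _))

  ⊛-comm : ∀ f g n → (f ⊛ g) n ≈ (g ⊛ f) n
  ⊛-comm f g zero    = *-comm _ _
  ⊛-comm f g (suc n) = begin
    f 0 * g (suc n) + (f ∘ suc ⊛ g) n  ≈⟨ +-cong (*-comm _ _) (⊛-comm (f ∘ suc) g n) ⟩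
    g (suc n) * f 0 + (g ⊛ f ∘ suc) n  ≈⟨ +-comm _ _ ⟩
    (g ⊛ f ∘ suc) n + g (suc n) * f 0  ≈⟨ ⊛-sucʳ g f n ⟨
    (g ⊛ f) (suc n)                    ∎

  ⊛-distribʳ : ∀ f g h n → ((λ i → f i + g i) ⊛ h) n ≈ (f ⊛ h) n + (g ⊛ h) n
  ⊛-distribʳ f g h zero    = distribʳ _ _ _
  ⊛-distribʳ f g h (suc n) = trans (+-congˡ (⊛-distribʳ (f ∘ suc) (g ∘ suc) h n))
    (solve 5 (λ a b c u v → (a :+ b) :* c :+ (u :+ v) := (a :* c :+ u) :+ (b :* c :+ v))
      refl (f 0) (g 0) (h (suc n)) ((f ∘ suc ⊛ h) n) ((g ∘ suc ⊛ h) n))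

  -- Weights that multiply along i + j = n factor out of the product. With powers of q as weights
  -- this becomes the multiplicativity of `σ`.
  ⊛-scale : ∀ {u v w : ℕ → A} → (∀ i j → u i * v j ≈ w (i ℕ.+ j)) → ∀ f g n →
            ((λ i → u i * f i) ⊛ (λ i → v i * g i)) n ≈ w n * (f ⊛ g) n
  ⊛-scale uv≈w f g zero = trans
    (solve 4 (λ a b c d → (a :* b) :* (c :* d) := (a :* c) :* (b :* d)) refl _ _ _ _)
    (*-congʳ (uv≈w 0 0))
  ⊛-scale {u} {v} {w} uv≈w f g (suc n) = begin
    u 0 * f 0 * (v (suc n) * g (suc n)) + ((λ i → u (suc i) * f (suc i)) ⊛ (λ i → v i * g i)) n
      ≈⟨ +-cong (solve 4 (λ a b c d → (a :* b) :* (c :* d) := (a :* c) :* (b :* d)) refl _ _ _ _)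
                (⊛-scale {w = w ∘ suc} (uv≈w ∘ suc) (f ∘ suc) g n) ⟩
    u 0 * v (suc n) * (f 0 * g (suc n)) + w (suc n) * (f ∘ suc ⊛ g) n
      ≈⟨ +-congʳ (*-congʳ (uv≈w 0 (suc n))) ⟩
    w (suc n) * (f 0 * g (suc n)) + w (suc n) * (f ∘ suc ⊛ g) n
      ≈⟨ distribˡ _ _ _ ⟨
    w (suc n) * (f ⊛ g) (suc n) ∎

  ⊛-scaleˡ : ∀ c f g n → ((λ i → c * f i) ⊛ g) n ≈ c * (f ⊛ g) n
  ⊛-scaleˡ c f g zero    = *-assoc _ _ _
  ⊛-scaleˡ c f g (suc n) = trans (+-cong (*-assoc _ _ _) (⊛-scaleˡ c (f ∘ suc) g n))
    (sym (distribˡ _ _ _))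

  ⊛-assoc : ∀ f g h n → ((f ⊛ g) ⊛ h) n ≈ (f ⊛ (g ⊛ h)) n
  ⊛-assoc f g h zero    = *-assoc _ _ _
  ⊛-assoc f g h (suc n) = begin
    f 0 * g 0 * h (suc n) + ((λ i → f 0 * g (suc i) + (f ∘ suc ⊛ g) i) ⊛ h) n
      ≈⟨ +-congˡ (⊛-distribʳ (λ i → f 0 * g (suc i)) (f ∘ suc ⊛ g) h n) ⟩
    f 0 * g 0 * h (suc n) + (((λ i → f 0 * g (suc i)) ⊛ h) n + ((f ∘ suc ⊛ g) ⊛ h) n)
      ≈⟨ +-congˡ (+-cong (⊛-scaleˡ (f 0) (g ∘ suc) h n) (⊛-assoc (f ∘ suc) g h n)) ⟩
    f 0 * g 0 * h (suc n) + (f 0 * (g ∘ suc ⊛ h) n + (f ∘ suc ⊛ (g ⊛ h)) n)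
      ≈⟨ solve 5 (λ a b c u v → (a :* b) :* c :+ (a :* u :+ v) := a :* (b :* c :+ u) :+ v)
           refl _ _ _ _ _ ⟩
    f 0 * (g 0 * h (suc n) + (g ∘ suc ⊛ h) n) + (f ∘ suc ⊛ (g ⊛ h)) n ∎

  ⊛-zeroˡ : ∀ {f} → (∀ i → f i ≈ 0#) → ∀ g n → (f ⊛ g) n ≈ 0#
  ⊛-zeroˡ f≈0 g zero    = trans (*-congʳ (f≈0 0)) (zeroˡ _)
  ⊛-zeroˡ f≈0 g (suc n) = trans (+-cong (trans (*-congʳ (f≈0 0)) (zeroˡ _))
    (⊛-zeroˡ (f≈0 ∘ suc) g n)) (+-identityˡ _)

  ⊛-identityˡ : ∀ {f} → f 0 ≈ 1# → (∀ i → f (suc i) ≈ 0#) → ∀ g n → (f ⊛ g) n ≈ g n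
  ⊛-identityˡ f₀ f₊ g zero    = trans (*-congʳ f₀) (*-identityˡ _)
  ⊛-identityˡ f₀ f₊ g (suc n) = trans
    (+-cong (trans (*-congʳ f₀) (*-identityˡ _)) (⊛-zeroˡ f₊ g n)) (+-identityʳ _)

  ⊛-shiftˡ : ∀ {f} → f 0 ≈ 0# → ∀ g n → (f ⊛ g) (suc n) ≈ (f ∘ suc ⊛ g) n
  ⊛-shiftˡ f₀ g n = trans (+-congʳ (trans (*-congʳ f₀) (zeroˡ _))) (+-identityˡ _)

-- The ring of Laurent series.

≤⇒≡+ : ∀ {i j} → i ℤ.≤ j → ∃ λ m → j ≡ i ℤ.+ + m
≤⇒≡+ {i} {j} i≤j = ℤ.∣ j ℤ.- i ∣ , (begin
  j                          ≡⟨ solve 2 (λ i j → j := i :+ (j :- i)) ≡.refl i j ⟩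
  i ℤ.+ (j ℤ.- i)            ≡⟨ ≡.cong (λ z → i ℤ.+ z) (ℤ.0≤i⇒+∣i∣≡i (ℤ.i≤j⇒0≤j-i i≤j)) ⟨
  i ℤ.+ + ℤ.∣ j ℤ.- i ∣      ∎)
  where
  open ≡.≡-Reasoning
  open ℤ.+-*-Solver

module LaurentRing (K : CommutativeRing 0ℓ 0ℓ) where

  open LaurentSeries K hiding (x)
  open CauchyProduct K
  open CommutativeRing K renaming (Carrier to A)
  open ℤ.+-*-Solver using (solve; _:=_; _:+_; _:-_; con)

  from : ℤ → Laurent → ℕ → A
  from a f i = coeff f (a ℤ.+ + i)

  VanishesBelow : ℤ → Laurent → Set
  VanishesBelow a f = ∀ k → k ℤ.< a → coeff f k ≈ 0#

  below : ∀ f {a} → a ℤ.≤ order f → VanishesBelow a f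
  below f a≤ k k< = vanish f k (ℤ.<-≤-trans k< a≤)

  coeff-cong : ∀ f {k l} → k ≡ l → coeff f k ≈ coeff f l
  coeff-cong f k≡l = reflexive (≡.cong (coeff f) k≡l)

  -- The two sides of a ring law may record different orders. Below a common bound both vanish, and
  -- above it only sequences indexed by ℕ remain to be compared.
  ≈ᴸ-from : ∀ f g a → VanishesBelow a f → VanishesBelow a g →
            (∀ n → from a f n ≈ from a g n) → f ≈ᴸ g
  ≈ᴸ-from f g a f< g< eq k with a ℤ.≤? k
  ... | no  a≰k = trans (f< k (ℤ.≰⇒> a≰k)) (sym (g< k (ℤ.≰⇒> a≰k)))
  ... | yes a≤k = let m , k≡ = ≤⇒≡+ a≤k in
    trans (coeff-cong f k≡) (trans (eq m) (coeff-cong g (≡.sym k≡)))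

  private
    from-order : ∀ f g n k → k ≡ order f ℤ.+ order g ℤ.+ + n →
                 coeff (f *ᴸ g) k ≈ (from (order f) f ⊛ from (order g) g) n
    -- Abstracting the number of summands together with its value `+ n` lets `#[0⋯_]` compute to
    -- `suc n`, the length that `sum-⊛` expects.
    from-order f g n k k≡ with k ℤ.- (order f ℤ.+ order g) | length
      where
      length : k ℤ.- (order f ℤ.+ order g) ≡ + n
      length = ≡.trans (≡.cong (ℤ._- (order f ℤ.+ order g)) k≡)
        (solve 2 (λ d n → d :+ n :- d := n) ≡.refl (order f ℤ.+ order g) (+ n))
    ... | _ | ≡.refl = sum-⊛ n _ λ j → *-congˡ (coeff-cong g (index (toℕ j) (ℕ.s≤s⁻¹ (Fin.toℕ<n j))))
      where
      index : ∀ j → j ≤ n → k ℤ.- (order f ℤ.+ + j) ≡ order g ℤ.+ + (n ∸ j)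
      index j j≤n = ≡.trans
        (≡.cong (ℤ._- (order f ℤ.+ + j)) (≡.trans k≡
          (≡.cong (λ m → order f ℤ.+ order g ℤ.+ + m) (≡.sym (ℕ.m∸n+n≡m j≤n)))))
        (solve 4 (λ a b m j → a :+ b :+ (m :+ j) :- (a :+ j) := b :+ m) ≡.refl
          (order f) (order g) (+ (n ∸ j)) (+ j))

    shift-index : ∀ a i → a ℤ.+ + suc i ≡ ℤ.suc a ℤ.+ + i
    shift-index a i = solve 2 (λ a i → a :+ (con 1ℤ :+ i) := con 1ℤ :+ a :+ i) ≡.refl a (+ i)

    suc-shift : ∀ {b} a {m} → b ≡ a ℤ.+ + suc m → b ≡ ℤ.suc a ℤ.+ + m
    suc-shift a {m} b≡ = ≡.trans b≡ (shift-index a m)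

    a<a+1+m : ∀ {b} a m → b ≡ a ℤ.+ + suc m → a ℤ.< b
    a<a+1+m a m ≡.refl =
      ≡.subst (ℤ._< a ℤ.+ + suc m) (ℤ.+-identityʳ a) (ℤ.+-monoʳ-< a (ℤ.+<+ (s≤s z≤n)))

    -- Lowering one of the base points by one prepends a zero.
    from-lowerˡ : ∀ f g a {b} m → order f ≡ a ℤ.+ + suc m → b ℤ.≤ order g →
      (∀ n k → k ≡ ℤ.suc a ℤ.+ b ℤ.+ + n → coeff (f *ᴸ g) k ≈ (from (ℤ.suc a) f ⊛ from b g) n) →
      ∀ n k → k ≡ a ℤ.+ b ℤ.+ + n → coeff (f *ᴸ g) k ≈ (from a f ⊛ from b g) n
    from-lowerˡ f g a {b} m a≡ b≤ ih n k k≡ = go n k≡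
      where
      fₐ≈0 : from a f 0 ≈ 0#
      fₐ≈0 = trans (coeff-cong f (ℤ.+-identityʳ a)) (vanish f a (a<a+1+m a m a≡))
      go : ∀ n → k ≡ a ℤ.+ b ℤ.+ + n → coeff (f *ᴸ g) k ≈ (from a f ⊛ from b g) n
      go zero k≡ = trans
        (vanish (f *ᴸ g) k (≡.subst (ℤ._< order f ℤ.+ order g)
          (≡.sym (≡.trans k≡ (ℤ.+-identityʳ _))) (ℤ.+-mono-<-≤ (a<a+1+m a m a≡) b≤)))
        (sym (trans (*-congʳ fₐ≈0) (zeroˡ _)))
      go (suc n) k≡ = trans
        (ih n k (≡.trans k≡ (solve 3 (λ a b n → a :+ b :+ (con 1ℤ :+ n) := con 1ℤ :+ a :+ b :+ n)
          ≡.refl a b (+ n))))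
        (trans (⊛-cong (λ i → sym (coeff-cong f (shift-index a i))) (λ _ → refl) n)
          (sym (⊛-shiftˡ {from a f} fₐ≈0 (from b g) n)))

    lowerˡ : ∀ f g {b} → b ℤ.≤ order g →
      (∀ n k → k ≡ order f ℤ.+ b ℤ.+ + n → coeff (f *ᴸ g) k ≈ (from (order f) f ⊛ from b g) n) →
      ∀ m a → order f ≡ a ℤ.+ + m →
      ∀ n k → k ≡ a ℤ.+ b ℤ.+ + n → coeff (f *ᴸ g) k ≈ (from a f ⊛ from b g) n
    lowerˡ f g b≤ base zero a a≡ with ≡.trans a≡ (ℤ.+-identityʳ a)
    ... | ≡.refl = base
    lowerˡ f g b≤ base (suc m) a a≡ =
      from-lowerˡ f g a m a≡ b≤ (lowerˡ f g b≤ base m (ℤ.suc a) (suc-shift a a≡))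

  *-comm-ᴸ : ∀ f g → f *ᴸ g ≈ᴸ g *ᴸ f
  *-comm-ᴸ f g = ≈ᴸ-from (f *ᴸ g) (g *ᴸ f) (order f ℤ.+ order g) (vanish (f *ᴸ g))
    (below (g *ᴸ f) (ℤ.≤-reflexive (ℤ.+-comm (order f) (order g))))
    λ n → trans (from-order f g n _ ≡.refl)
      (trans (⊛-comm (from (order f) f) (from (order g) g) n)
        (sym (from-order g f n _ (≡.cong (ℤ._+ + n) (ℤ.+-comm (order f) (order g))))))

  -- The recorded orders only fix where the summation starts, and starting lower adds zero terms.
  -- This freedom allows products with different recorded orders to be compared term by term.
  coeff-* : ∀ f g {a b} → a ℤ.≤ order f → b ℤ.≤ order g →
            ∀ n k → k ≡ a ℤ.+ b ℤ.+ + n → coeff (f *ᴸ g) k ≈ (from a f ⊛ from b g) n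
  coeff-* f g {a} {b} a≤ b≤ = let m , a≡ = ≤⇒≡+ a≤ ; m′ , b≡ = ≤⇒≡+ b≤ in
    lowerˡ f g b≤
      -- `lowerˡ` moves the base point of the left factor only, so that of `g` is moved first, with
      -- the factors exchanged.
      (swap f g b (lowerˡ g f ℤ.≤-refl (from-order g f) m′ b b≡))
      m a a≡
    where
    swap : ∀ f g b →
      (∀ n k → k ≡ b ℤ.+ order f ℤ.+ + n → coeff (g *ᴸ f) k ≈ (from b g ⊛ from (order f) f) n) →
      ∀ n k → k ≡ order f ℤ.+ b ℤ.+ + n → coeff (f *ᴸ g) k ≈ (from (order f) f ⊛ from b g) n
    swap f g b gf n k k≡ = trans (*-comm-ᴸ f g k)
      (trans (gf n k (≡.trans k≡ (≡.cong (ℤ._+ + n) (ℤ.+-comm (order f) b))))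
        (⊛-comm (from b g) (from (order f) f) n))

  -- Equal series may carry different orders, hence the minima as common base points.
  *-cong-ᴸ : ∀ {f f′ g g′} → f ≈ᴸ f′ → g ≈ᴸ g′ → f *ᴸ g ≈ᴸ f′ *ᴸ g′
  *-cong-ᴸ {f} {f′} {g} {g′} f≈ g≈ = ≈ᴸ-from (f *ᴸ g) (f′ *ᴸ g′) (a ℤ.+ b)
    (below (f *ᴸ g) (ℤ.+-mono-≤ a≤ b≤)) (below (f′ *ᴸ g′) (ℤ.+-mono-≤ a≤′ b≤′))
    λ n → trans (coeff-* f g a≤ b≤ n _ ≡.refl)
      (trans (⊛-cong (λ i → f≈ (a ℤ.+ + i)) (λ i → g≈ (b ℤ.+ + i)) n)
        (sym (coeff-* f′ g′ a≤′ b≤′ n _ ≡.refl)))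
    where
    a = order f ℤ.⊓ order f′
    b = order g ℤ.⊓ order g′
    a≤  = ℤ.i⊓j≤i (order f) (order f′)
    a≤′ = ℤ.i⊓j≤j (order f) (order f′)
    b≤  = ℤ.i⊓j≤i (order g) (order g′)
    b≤′ = ℤ.i⊓j≤j (order g) (order g′)

  *-assoc-ᴸ : ∀ f g h → (f *ᴸ g) *ᴸ h ≈ᴸ f *ᴸ (g *ᴸ h)
  *-assoc-ᴸ f g h = ≈ᴸ-from (f *ᴸ g *ᴸ h) (f *ᴸ (g *ᴸ h)) (a ℤ.+ b ℤ.+ c) (vanish (f *ᴸ g *ᴸ h))
    (below (f *ᴸ (g *ᴸ h)) (ℤ.≤-reflexive (ℤ.+-assoc a b c)))
    λ n → begin
      from (a ℤ.+ b ℤ.+ c) (f *ᴸ g *ᴸ h) n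
        ≈⟨ coeff-* (f *ᴸ g) h ℤ.≤-refl ℤ.≤-refl n _ ≡.refl ⟩
      (from (a ℤ.+ b) (f *ᴸ g) ⊛ from c h) n
        ≈⟨ ⊛-cong (λ i → coeff-* f g ℤ.≤-refl ℤ.≤-refl i _ ≡.refl) (λ _ → refl) n ⟩
      (from a f ⊛ from b g ⊛ from c h) n
        ≈⟨ ⊛-assoc (from a f) (from b g) (from c h) n ⟩
      (from a f ⊛ (from b g ⊛ from c h)) n
        ≈⟨ ⊛-cong (λ _ → refl) (λ i → coeff-* g h ℤ.≤-refl ℤ.≤-refl i _ ≡.refl) n ⟨
      (from a f ⊛ from (b ℤ.+ c) (g *ᴸ h)) n
        ≈⟨ coeff-* f (g *ᴸ h) ℤ.≤-refl ℤ.≤-refl n _ (≡.cong (ℤ._+ + n) (ℤ.+-assoc a b c)) ⟨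
      from (a ℤ.+ b ℤ.+ c) (f *ᴸ (g *ᴸ h)) n ∎
    where
    open import Relation.Binary.Reasoning.Setoid setoid
    a = order f
    b = order g
    c = order h

  *-distribʳ-ᴸ : ∀ h f g → (f +ᴸ g) *ᴸ h ≈ᴸ f *ᴸ h +ᴸ g *ᴸ h
  *-distribʳ-ᴸ h f g = ≈ᴸ-from ((f +ᴸ g) *ᴸ h) (f *ᴸ h +ᴸ g *ᴸ h) (a ℤ.+ c) (vanish ((f +ᴸ g) *ᴸ h))
    (below (f *ᴸ h +ᴸ g *ᴸ h) (ℤ.⊓-glb (ℤ.+-monoˡ-≤ c a≤f) (ℤ.+-monoˡ-≤ c a≤g)))
    λ n → trans (coeff-* (f +ᴸ g) h ℤ.≤-refl ℤ.≤-refl n _ ≡.refl)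
      (trans (⊛-distribʳ (from a f) (from a g) (from c h) n)
        (sym (+-cong (coeff-* f h a≤f ℤ.≤-refl n _ ≡.refl)
                     (coeff-* g h a≤g ℤ.≤-refl n _ ≡.refl))))
    where
    a = order f ℤ.⊓ order g
    c = order h
    a≤f = ℤ.i⊓j≤i (order f) (order g)
    a≤g = ℤ.i⊓j≤j (order f) (order g)

  *-identityˡ-ᴸ : ∀ f → 1ᴸ *ᴸ f ≈ᴸ f
  *-identityˡ-ᴸ f = ≈ᴸ-from (1ᴸ *ᴸ f) f (0ℤ ℤ.+ order f) (vanish (1ᴸ *ᴸ f))
    (below f (ℤ.≤-reflexive (ℤ.+-identityˡ _)))
    λ n → trans (coeff-* 1ᴸ f ℤ.≤-refl ℤ.≤-refl n _ ≡.refl)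
      (trans (⊛-identityˡ refl (λ _ → refl) (from (order f) f) n)
        (coeff-cong f (≡.cong (ℤ._+ + n) (≡.sym (ℤ.+-identityˡ (order f))))))

  coeff-0ᴸ : ∀ k → coeff 0ᴸ k ≈ 0#
  coeff-0ᴸ k with k ℤ.≟ + 0
  ... | yes _ = refl
  ... | no  _ = refl

  private
    isEquivalenceᴸ : IsEquivalence _≈ᴸ_
    isEquivalenceᴸ = record
      { refl  = λ _ → refl
      ; sym   = λ p k → sym (p k)
      ; trans = λ p q k → trans (p k) (q k)
      }
    module ≈ᴸ = IsEquivalence isEquivalenceᴸ

  laurentRing : CommutativeRing 0ℓ 0ℓ
  laurentRing = record
    { Carrier = Laurent ; _≈_ = _≈ᴸ_ ; _+_ = _+ᴸ_ ; _*_ = _*ᴸ_ ; -_ = -ᴸ_ ; 0# = 0ᴸ ; 1# = 1ᴸ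
    ; isCommutativeRing = record
      { isRing = record
        { +-isAbelianGroup = record
          { isGroup = record
            { isMonoid = record
              { isSemigroup = record
                { isMagma = record
                  { isEquivalence = isEquivalenceᴸ
                  ; ∙-cong = λ p q k → +-cong (p k) (q k)
                  }
                ; assoc = λ f g h k → +-assoc _ _ _
                }
              ; identity = (λ f k → trans (+-congʳ (coeff-0ᴸ k)) (+-identityˡ _))
                         , (λ f k → trans (+-congˡ (coeff-0ᴸ k)) (+-identityʳ _))
              }
            ; inverse = (λ f k → trans (-‿inverseˡ _) (sym (coeff-0ᴸ k)))
                      , (λ f k → trans (-‿inverseʳ _) (sym (coeff-0ᴸ k)))
            ; ⁻¹-cong = λ p k → -‿cong (p k)
            }
          ; comm = λ f g k → +-comm _ _
          }
        ; *-cong = λ {f} {f′} {g} {g′} → *-cong-ᴸ {f} {f′} {g} {g′}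
        ; *-assoc = *-assoc-ᴸ
        ; *-identity = *-identityˡ-ᴸ
                     , λ f → ≈ᴸ.trans {f *ᴸ 1ᴸ} {1ᴸ *ᴸ f} {f} (*-comm-ᴸ f 1ᴸ) (*-identityˡ-ᴸ f)
        ; distrib = (λ h f g → ≈ᴸ.trans {h *ᴸ (f +ᴸ g)} {(f +ᴸ g) *ᴸ h} {h *ᴸ f +ᴸ h *ᴸ g}
                       (*-comm-ᴸ h (f +ᴸ g))
                       (≈ᴸ.trans {(f +ᴸ g) *ᴸ h} {f *ᴸ h +ᴸ g *ᴸ h} {h *ᴸ f +ᴸ h *ᴸ g}
                         (*-distribʳ-ᴸ h f g)
                         (λ k → +-cong (*-comm-ᴸ f h k) (*-comm-ᴸ g h k))))
                  , *-distribʳ-ᴸ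
        }
      ; *-comm = *-comm-ᴸ
      }
    }

-- Inverses of power series and of Laurent series.

module ReciprocalProperties (em : ExcludedMiddle 0ℓ) (R : RawRing 0ℓ 0ℓ) where

  open RawRing R
  open Reciprocal em R

  ⁻¹-inverseʳ : ∀ a → (∃ λ b → a * b ≈ 1#) → a * a ⁻¹ ≈ 1#
  ⁻¹-inverseʳ a inv with em {∃ λ b → a * b ≈ 1#}
  ... | yes (_ , ab≈1) = ab≈1
  ... | no  ¬inv       = contradiction inv ¬inv

HasInverses : CommutativeRing 0ℓ 0ℓ → Set
HasInverses K = ∀ a → ¬ a ≈ 0# → ∃ λ b → a * b ≈ 1#
  where open CommutativeRing K

module PowerSeriesInverse (K : CommutativeRing 0ℓ 0ℓ) where

  open CauchyProduct K
  open CommutativeRing K renaming (Carrier to A)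
  open RingProperties ring using (-‿distribʳ-*)

  module _ (f : ℕ → A) (c : A) (f₀c≈1 : f 0 * c ≈ 1#) where

    private
      -- Only the first m coefficients of approx m are those of the inverse.
      approx : ℕ → ℕ → A
      approx zero    _       = 0#
      approx (suc m) zero    = c
      approx (suc m) (suc n) = - (c * (f ∘ suc ⊛ approx m) n)

      stable : ∀ m m′ {n} → n < m → n < m′ → approx m n ≈ approx m′ n
      stable (suc m) (suc m′) {zero}  _ _ = refl
      stable (suc m) (suc m′) {suc n} (s≤s n<m) (s≤s n<m′) =
        -‿cong (*-congˡ (⊛-cong-≤ n (λ _ → refl)
          λ i≤n → stable m m′ (ℕ.≤-<-trans i≤n n<m) (ℕ.≤-<-trans i≤n n<m′)))

    -- The recursion for an inverse series refers to all earlier coefficients, so `approx` carries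
    -- fuel; `suc n` is just enough for coefficient n.
    inverse : ℕ → A
    inverse n = approx (suc n) n

    ⊛-inverse-suc : ∀ n → (f ⊛ inverse) (suc n) ≈ 0#
    ⊛-inverse-suc n = begin
      f 0 * - (c * (f ∘ suc ⊛ approx (suc n)) n) + s
        -- Unfolding leaves all coefficients with the same fuel `suc n`; `stable` replaces each by
        -- its diagonal value.
        ≈⟨ +-congʳ (*-congˡ (-‿cong (*-congˡ (⊛-cong-≤ n (λ _ → refl)
             λ {i} i≤n → stable (suc n) (suc i) (s≤s i≤n) ℕ.≤-refl)))) ⟩
      f 0 * - (c * s) + s    ≈⟨ +-congʳ (-‿distribʳ-* (f 0) (c * s)) ⟨
      - (f 0 * (c * s)) + s  ≈⟨ +-congʳ (-‿cong (*-assoc (f 0) c s)) ⟨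
      - (f 0 * c * s) + s    ≈⟨ +-congʳ (-‿cong (trans (*-congʳ f₀c≈1) (*-identityˡ s))) ⟩
      - s + s                ≈⟨ -‿inverseˡ s ⟩
      0#                     ∎
      where
      open import Relation.Binary.Reasoning.Setoid setoid
      s = (f ∘ suc ⊛ inverse) n

module LeadingTerms (em : ExcludedMiddle 0ℓ) (K : CommutativeRing 0ℓ 0ℓ) (inv : HasInverses K) where

  open LaurentSeries K hiding (x)
  open CauchyProduct K
  open LaurentRing K
  open CommutativeRing K renaming (Carrier to A)
  open PowerSeriesInverse K

  -- The exact order of a series, intrinsic where `order` is merely some lower bound.
  Leads : ℤ → Laurent → Set
  Leads d f = VanishesBelow d f × ¬ coeff f d ≈ 0#

  module _ (f : Laurent) {d : ℤ} (f<d : VanishesBelow d f) where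

    reorder : Laurent
    reorder = record { coeff = coeff f ; order = d ; vanish = f<d }

  -- `vanish` of a product knows only the recorded orders, so `reorder` records the given bounds
  -- first.
  VanishesBelow-* : ∀ f g {a b} → VanishesBelow a f → VanishesBelow b g →
                    VanishesBelow (a ℤ.+ b) (f *ᴸ g)
  VanishesBelow-* f g f< g< k k< = trans
    (*-cong-ᴸ {f} {reorder f f<} {g} {reorder g g<} (λ _ → refl) (λ _ → refl) k)
    (vanish (reorder f f< *ᴸ reorder g g<) k k<)

  private
    -- Vanishing of a coefficient is not decidable, so the search consults excluded middle at each
    -- index; the known nonzero index n bounds it.
    least : (s : ℕ → A) → ∀ n → ¬ s n ≈ 0# →
            ∃ λ m → (∀ {i} → i < m → s i ≈ 0#) × ¬ s m ≈ 0#
    least s n sₙ≉0 with em {s 0 ≈ 0#}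
    least s n       sₙ≉0 | no  s₀≉0 = 0 , (λ ()) , s₀≉0
    least s zero    sₙ≉0 | yes s₀≈0 = contradiction s₀≈0 sₙ≉0
    least s (suc n) sₙ≉0 | yes s₀≈0 with least (s ∘ suc) n sₙ≉0
    ... | m , below , sₘ≉0 = suc m , (λ { {zero} _ → s₀≈0 ; {suc i} (s≤s i<m) → below i<m }) , sₘ≉0

  leading : ∀ f → ¬ f ≈ᴸ 0ᴸ → ∃ λ d → Leads d f
  leading f f≉0 with em {∃ λ n → ¬ from (order f) f n ≈ 0#}
  ... | yes (n , fₙ≉0) = let m , f≈0 , fₘ≉0 = least (from (order f) f) n fₙ≉0 in
        order f ℤ.+ + m , below-m m f≈0 , fₘ≉0
    where
    below-m : ∀ m → (∀ {i} → i < m → from (order f) f i ≈ 0#) → VanishesBelow (order f ℤ.+ + m) f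
    below-m m f≈0 k k< with order f ℤ.≤? k
    ... | no  o≰k = vanish f k (ℤ.≰⇒> o≰k)
    ... | yes o≤k with ≤⇒≡+ o≤k
    ...   | i , ≡.refl = f≈0 (ℕ.≰⇒> λ m≤i → ℤ.<⇒≱ k< (ℤ.+-monoʳ-≤ (order f) (ℤ.+≤+ m≤i)))
  ... | no ¬fₙ≉0 = contradiction
        (≈ᴸ-from f 0ᴸ (order f) (vanish f) (λ k _ → coeff-0ᴸ k)
          λ n → trans (all-0 n) (sym (coeff-0ᴸ (order f ℤ.+ + n))))
        f≉0
    where
    all-0 : ∀ n → from (order f) f n ≈ 0#
    all-0 n with em {from (order f) f n ≈ 0#}
    ... | yes fₙ≈0 = fₙ≈0
    ... | no  fₙ≉0 = contradiction (n , fₙ≉0) ¬fₙ≉0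

  private
    extend : (ℕ → A) → ℤ → A
    extend g (+ n)    = g n
    extend g -[1+ _ ] = 0#

    extend-< : ∀ g k → k ℤ.< 0ℤ → extend g k ≈ 0#
    extend-< g -[1+ _ ] _ = refl
    extend-< g (+ n) (ℤ.+<+ ())

  -- Shifted by d, the series is a power series with invertible constant term. The inverse power
  -- series, shifted by -d, inverts the original.
  leads⇒invertible : ∀ f {d} → Leads d f → ∃ λ g → f *ᴸ g ≈ᴸ 1ᴸ
  leads⇒invertible f {d} (f<d , fd≉0) = g , λ k → trans
    (*-cong-ᴸ {f} {f̂} {g} {g} (λ _ → refl) (λ _ → refl) k)
    (≈ᴸ-from (f̂ *ᴸ g) 1ᴸ (d ℤ.- d) (vanish (f̂ *ᴸ g)) (below 1ᴸ (ℤ.≤-reflexive d-d≡0))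
      (λ n → trans (coeff-* f̂ g ℤ.≤-refl ℤ.≤-refl n _ ≡.refl)
        (trans (⊛-cong (λ _ → refl) g-coeff n)
          (trans (prod n) (coeff-cong 1ᴸ (≡.cong (ℤ._+ + n) (≡.sym d-d≡0)))))) k)
    where
    open ℤ.+-*-Solver using (solve; _:=_; _:+_; :-_)
    d-d≡0 = ℤ.+-inverseʳ d
    f̂ = reorder f f<d
    s = from d f
    s₀≉0 : ¬ s 0 ≈ 0#
    s₀≉0 = fd≉0 ∘ trans (coeff-cong f (≡.sym (ℤ.+-identityʳ d)))
    c    = proj₁ (inv (s 0) s₀≉0)
    cinv = proj₂ (inv (s 0) s₀≉0)
    t = inverse s c cinv
    g : Laurent
    g = record
      { coeff  = λ k → extend t (k ℤ.+ d)
      ; order  = ℤ.- d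
      ; vanish = λ k k< → extend-< t (k ℤ.+ d)
          (≡.subst (k ℤ.+ d ℤ.<_) (ℤ.+-inverseˡ d) (ℤ.+-monoˡ-< d k<))
      }
    g-coeff : ∀ i → from (ℤ.- d) g i ≈ t i
    g-coeff i = reflexive (≡.cong (extend t)
      (solve 2 (λ d i → :- d :+ i :+ d := i) ≡.refl d (+ i)))
    prod : ∀ n → (s ⊛ t) n ≈ coeff 1ᴸ (+ n)
    prod zero    = cinv
    prod (suc n) = ⊛-inverse-suc s c cinv n

-- The automorphism `σ` and the leading terms of the series Pₘ.

module QDifferenceProperties (em : ExcludedMiddle 0ℓ) (K : CommutativeRing 0ℓ 0ℓ) (inv : HasInverses K)
  (q : CommutativeRing.Carrier K) (q≉0 : ¬ CommutativeRing._≈_ K q (CommutativeRing.0# K)) where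

  open LaurentSeries K
  open CauchyProduct K
  open LaurentRing K
  open LeadingTerms em K inv
  open QDifference em K q
  open CommutativeRing K renaming (Carrier to A)
  open RawSemiringDefinitions (RawRing.rawSemiring rawRing) using (_^_)
  open Reciprocal em rawRing using (_⁻¹)
  open Endomap Laurent using () renaming (_^_ to _^∘_)
  open RingProperties ring using (-‿distribʳ-*)

  private
    q*q⁻¹≈1 : q * q ⁻¹ ≈ 1#
    q*q⁻¹≈1 = ReciprocalProperties.⁻¹-inverseʳ em rawRing q (inv q q≉0)

    cancel : ∀ a → q * (q ⁻¹ * a) ≈ a
    cancel a = trans (sym (*-assoc _ _ _)) (trans (*-congʳ q*q⁻¹≈1) (*-identityˡ a))

    cancel′ : ∀ a → q ⁻¹ * (q * a) ≈ a
    cancel′ a = trans (sym (*-assoc _ _ _)) (trans (*-congʳ (trans (*-comm _ _) q*q⁻¹≈1)) (*-identityˡ a))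

    q^suc : ∀ i → q^ ℤ.suc i ≈ q * q^ i
    q^suc (+ n)          = refl
    q^suc -[1+ zero ]    = sym (cancel 1#)
    q^suc -[1+ suc n ]   = sym (cancel _)

    q^pred : ∀ i → q^ ℤ.pred i ≈ q ⁻¹ * q^ i
    q^pred i = trans (sym (cancel′ _))
      (*-congˡ (trans (sym (q^suc (ℤ.pred i))) (reflexive (≡.cong q^_ (ℤ.suc-pred i)))))

  -- Induction on the absolute value of i: `q^suc` and `q^pred` move it one step towards 0, and both
  -- rest on q being invertible.
  q^-homo-+ : ∀ i j → q^ (i ℤ.+ j) ≈ q^ i * q^ j
  q^-homo-+ (+ zero) j = trans (reflexive (≡.cong q^_ (ℤ.+-identityˡ j))) (sym (*-identityˡ _))
  q^-homo-+ (+ suc n) j = trans (reflexive (≡.cong q^_ (ℤ.+-assoc 1ℤ (+ n) j)))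
    (trans (q^suc (+ n ℤ.+ j)) (trans (*-congˡ (q^-homo-+ (+ n) j)) (sym (*-assoc _ _ _))))
  q^-homo-+ -[1+ zero ] j = trans (q^pred j) (*-congʳ (sym (*-identityʳ _)))
  q^-homo-+ -[1+ suc n ] j = trans (reflexive (≡.cong q^_ (ℤ.+-assoc ℤ.-1ℤ -[1+ n ] j)))
    (trans (q^pred (-[1+ n ] ℤ.+ j)) (trans (*-congˡ (q^-homo-+ -[1+ n ] j)) (sym (*-assoc _ _ _))))

  σ-cong : ∀ {f g} → f ≈ᴸ g → σ f ≈ᴸ σ g
  σ-cong f≈g k = *-congˡ (f≈g k)

  σ-homo-+ : ∀ f g → σ (f +ᴸ g) ≈ᴸ σ f +ᴸ σ g
  σ-homo-+ f g k = distribˡ _ _ _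

  σ-homo-neg : ∀ f → σ (-ᴸ f) ≈ᴸ -ᴸ σ f
  σ-homo-neg f k = sym (-‿distribʳ-* _ _)

  σ-homo-0 : σ 0ᴸ ≈ᴸ 0ᴸ
  σ-homo-0 k = trans (*-congˡ (coeff-0ᴸ k)) (trans (zeroʳ _) (sym (coeff-0ᴸ k)))

  σ-homo-1 : σ 1ᴸ ≈ᴸ 1ᴸ
  σ-homo-1 k with k ℤ.≟ + 0
  ... | yes ≡.refl = *-identityˡ _
  ... | no  _      = zeroʳ _

  σ-homo-* : ∀ f g → σ (f *ᴸ g) ≈ᴸ σ f *ᴸ σ g
  σ-homo-* f g = ≈ᴸ-from (σ (f *ᴸ g)) (σ f *ᴸ σ g) (a ℤ.+ b)
    (vanish (σ (f *ᴸ g))) (vanish (σ f *ᴸ σ g))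
    λ n → trans (*-congˡ (coeff-* f g ℤ.≤-refl ℤ.≤-refl n _ ≡.refl))
      (trans (sym (⊛-scale {w = λ n → q^ (a ℤ.+ b ℤ.+ + n)} weights (from a f) (from b g) n))
        (sym (coeff-* (σ f) (σ g) ℤ.≤-refl ℤ.≤-refl n _ ≡.refl)))
    where
    open ℤ.+-*-Solver using (solve; _:=_; _:+_)
    a = order f
    b = order g
    weights : ∀ i j → q^ (a ℤ.+ + i) * q^ (b ℤ.+ + j) ≈ q^ (a ℤ.+ b ℤ.+ + (i ℕ.+ j))
    weights i j = trans (sym (q^-homo-+ (a ℤ.+ + i) (b ℤ.+ + j))) (reflexive (≡.cong q^_
      (solve 4 (λ a b i j → a :+ i :+ (b :+ j) := a :+ b :+ (i :+ j)) ≡.refl a b (+ i) (+ j))))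

  module _ (P : Laurent) {d : ℤ} (lead : Leads d P) where

    private
      weaken : ∀ g → VanishesBelow (ℤ.suc d) g → VanishesBelow d g
      weaken g g< k k< = g< k (ℤ.<-≤-trans k< (ℤ.i≤suc[i] d))

      -- The factor x raises the bound by one, while `σ` acts on each coefficient separately and
      -- keeps it. Hence every term of Pₘ after the first starts beyond the leading exponent of P.
      -xσ-vanishes : ∀ g → VanishesBelow d g → VanishesBelow (ℤ.suc d) (-xσ g)
      -xσ-vanishes g g< = VanishesBelow-* (-ᴸ x) (σ g) (vanish (-ᴸ x))
        λ k k< → trans (*-congˡ (g< k k<)) (zeroʳ _)

      iterate-vanishes : ∀ j → VanishesBelow d ((-xσ ^∘ j) P)
      iterate-vanishes zero    = proj₁ lead
      iterate-vanishes (suc j) = weaken ((-xσ ^∘ suc j) P) (-xσ-vanishes ((-xσ ^∘ j) P) (iterate-vanishes j))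

      sum-vanishes : ∀ {e} m (t : Fin m → Laurent) → (∀ j → VanishesBelow e (t j)) →
                     VanishesBelow e (sumᴸ t)
      sum-vanishes zero    t t< k k< = coeff-0ᴸ k
      sum-vanishes (suc m) t t< k k< = trans
        (+-cong (t< Fin.zero k k<) (sum-vanishes m (t ∘ Fin.suc) (t< ∘ Fin.suc) k k<))
        (+-identityˡ _)

      tail : ∀ m k → k ℤ.< ℤ.suc d → coeff (sumᴸ {m} λ j → (-xσ ^∘ suc (toℕ j)) P) k ≈ 0#
      tail m = sum-vanishes m (λ j → (-xσ ^∘ suc (toℕ j)) P)
        λ j → -xσ-vanishes ((-xσ ^∘ toℕ j) P) (iterate-vanishes (toℕ j))

      head : ∀ m k → k ℤ.< ℤ.suc d → coeff (P[ P ] (suc m)) k ≈ coeff P k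
      head m k k< = trans (+-congˡ (tail m k k<)) (+-identityʳ _)

    P[]-leads : ∀ m → Leads d (P[ P ] (suc m))
    P[]-leads m = (λ k k< → trans (head m k (ℤ.<-≤-trans k< (ℤ.i≤suc[i] d))) (proj₁ lead k k<))
                , λ ≈0 → proj₂ lead (trans (sym (head m d (ℤ.suc[i]≤j⇒i<j ℤ.≤-refl))) ≈0)

-- Complete homogeneous symmetric polynomials.

module CompleteHomogeneous (R : CommutativeRing 0ℓ 0ℓ) where

  open CommutativeRing R renaming (Carrier to A)
  open RawSemiringDefinitions (RawRing.rawSemiring rawRing) using (_^_)
  open SemiringSolver commutativeSemiring using (solve; _:+_; _:*_; _:=_)

  -- The complete homogeneous symmetric polynomial of degree j in s₀ … sₘ₋₁.
  h : (ℕ → A) → ℕ → ℕ → A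
  h s m       zero    = 1#
  h s zero    (suc j) = 0#
  h s (suc m) (suc j) = s 0 * h s (suc m) j + h (s ∘ suc) m (suc j)

  private
    -- With Hⱼ = hⱼ(s₀,...,sₘ) and j positive, both s₀(Hⱼ - hⱼ(s₀,...,sₘ₋₁)) and sₘ(Hⱼ -
    -- hⱼ(s₁,...,sₘ)) are s₀sₘHⱼ₋₁, the first by `h-last`, the second by the defining recursion. The
    -- form without subtraction suits the semiring solver.
    exchange : ∀ s m j → s 0 * h s (suc m) j + s m * h (s ∘ suc) m j ≈
                         s m * h s (suc m) j + s 0 * h s m j

  -- The defining recursion splits off the first variable, this one the last. The induction
  -- hypothesis for s₁,...,sₘ is regrouped by `exchange`, which in turn calls `h-last` only in a
  -- lower degree.
  h-last : ∀ s m j → h s (suc m) (suc j) ≈ s m * h s (suc m) j + h s m (suc j)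

  exchange s m zero    = +-comm _ _
  exchange s zero (suc j) = refl
  exchange s (suc m) (suc j) = trans (+-congʳ (*-congˡ (h-last s (suc m) j)))
    (solve 5 (λ a b u v w → a :* (b :* u :+ v) :+ b :* w := b :* (a :* u :+ w) :+ a :* v)
      refl (s 0) (s (suc m)) (h s (suc (suc m)) j) (h s (suc m) (suc j))
      (h (s ∘ suc) (suc m) (suc j)))

  h-last s zero    j = refl
  h-last s (suc m) j = trans (+-congˡ (h-last (s ∘ suc) m j))
    (trans (sym (+-assoc _ _ _)) (trans (+-congʳ (exchange s (suc m) j)) (+-assoc _ _ _)))

  -- Degree j + 1 in s₀,...,sₘ is expanded once along s₀ and once along sₘ, and the two expansions
  -- are compared.
  h-difference : ∀ s m j → h (s ∘ suc) m (suc j) - h s m (suc j) ≈ (s m - s 0) * h s (suc m) j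
  h-difference s m j = begin
    h′ - h″                      ≈⟨ +-congʳ (+-identityˡ h′) ⟨
    0# + h′ - h″                 ≈⟨ +-congʳ (+-congʳ (-‿inverseˡ (s 0 * H))) ⟨
    - (s 0 * H) + s 0 * H + h′ - h″  ≈⟨ +-congʳ (+-assoc _ _ _) ⟩
    - (s 0 * H) + (s 0 * H + h′) - h″  ≈⟨ +-congʳ (+-congˡ (h-last s m j)) ⟩
    - (s 0 * H) + (s m * H + h″) - h″
      ≈⟨ solve 4 (λ a b c d → a :+ (b :+ c) :+ d := (b :+ a) :+ (c :+ d)) refl _ _ _ _ ⟩
    s m * H - s 0 * H + (h″ - h″)      ≈⟨ +-congˡ (-‿inverseʳ h″) ⟩
    s m * H - s 0 * H + 0#             ≈⟨ +-identityʳ _ ⟩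
    s m * H - s 0 * H                  ≈⟨ +-congˡ (-‿distribˡ-* (s 0) H) ⟩
    s m * H + - s 0 * H                ≈⟨ distribʳ _ _ _ ⟨
    (s m - s 0) * H                    ∎
    where
    open import Relation.Binary.Reasoning.Setoid setoid
    open RingProperties ring using (-‿distribˡ-*)
    H  = h s (suc m) j
    h′ = h (s ∘ suc) m (suc j)
    h″ = h s m (suc j)

  h-single : ∀ s j → h s 1 j ≈ s 0 ^ j
  h-single s zero    = refl
  h-single s (suc j) = trans (+-identityʳ _) (*-congˡ (h-single s j))

-- The exponent of the sign.

consecutiveSum : ℕ → ℕ → ℕ
consecutiveSum zero    m = 0
consecutiveSum (suc r) m = m ℕ.+ consecutiveSum r (suc m)

-- The sum is m + (m + 1) + ... + (m + r - 1). Doubling avoids division, and the separate case r = 1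
-- lets the truncated subtraction compute in the inductive step.
consecutiveSum*2 : ∀ r m → consecutiveSum r m ℕ.* 2 ≡ r ℕ.* (r ∸ 1) ℕ.+ r ℕ.* m ℕ.* 2
consecutiveSum*2 zero          m = ≡.refl
consecutiveSum*2 (suc zero)    m = solve 1 (λ m → (m :+ con 0) :* con 2 := (m :+ con 0) :* con 2) ≡.refl m
  where open ℕ.+-*-Solver
consecutiveSum*2 (suc (suc r)) m = ≡.trans (ℕ.*-distribʳ-+ 2 m (consecutiveSum (suc r) (suc m)))
  (≡.trans (≡.cong (m ℕ.* 2 ℕ.+_) (consecutiveSum*2 (suc r) (suc m)))
    (solve 2 (λ r m → m :* con 2 :+ ((con 1 :+ r) :* r :+ (con 1 :+ r) :* (con 1 :+ m) :* con 2)
                    := (con 2 :+ r) :* (con 1 :+ r) :+ (con 2 :+ r) :* m :* con 2) ≡.refl r m))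
  where open ℕ.+-*-Solver

consecutiveSum-0 : ∀ n → consecutiveSum n 0 ≡ (n ℕ.* (n ∸ 1)) / 2
consecutiveSum-0 n = ≡.trans (≡.sym (m*n/n≡m (consecutiveSum n 0) 2)) (≡.cong (_/ 2)
  (≡.trans (consecutiveSum*2 n 0) (≡.trans
    (≡.cong (λ k → n ℕ.* (n ∸ 1) ℕ.+ k ℕ.* 2) (ℕ.*-zeroʳ n)) (ℕ.+-identityʳ _))))

-- Descent in degree along the factors of L.

module Descent (R : CommutativeRing 0ℓ 0ℓ) where

  open CommutativeRing R renaming (Carrier to A)

  module _ {σ : A → A} (σ-hom : IsRingHomomorphism rawRing rawRing σ) (x P f : A)
    (xσf+f≈P : x * σ f + f ≈ P) where

    open CompleteHomogeneous R
    open IsRingHomomorphism σ-hom using (⟦⟧-cong; +-homo; *-homo; 0#-homo; 1#-homo; -‿homo)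
    open RawSemiringDefinitions (RawRing.rawSemiring rawRing) using (_^_; sum)
    open Exp commutativeSemiring using (^-congˡ; ^-congʳ; ^-homo-*; ^-distrib-*)
    open Endomap A using (Endo) renaming (_^_ to _^∘_)
    open SemiringSolver commutativeSemiring using (solve; _:+_; _:*_; _:=_)
    open RingProperties ring
      using (-1*x≈-x; -‿distribˡ-*; -‿distribʳ-*; -‿involutive; -‿+-comm; -0#≈0#; //-rightDividesʳ)
    open import Relation.Binary.Reasoning.Setoid setoid

    private
      T : Endo
      T g = - x * σ g

      -- Over Laurent series `T` and `p` unfold to `-xσ` and `P[ P ]`, so `descent-power` applies to
      -- `L` as it stands.
      p : ℕ → A
      p m = sum {m} λ k → (T ^∘ toℕ k) P

      s : ℕ → A
      s k = f - p k

    T-homo-+ : ∀ g g′ → T (g + g′) ≈ T g + T g′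
    T-homo-+ g g′ = trans (*-congˡ (+-homo g g′)) (distribˡ _ _ _)

    T-sum : ∀ m (t : Fin m → A) → T (sum t) ≈ sum (T ∘ t)
    T-sum zero    t = trans (*-congˡ 0#-homo) (zeroʳ _)
    T-sum (suc m) t = trans (T-homo-+ _ _) (+-congˡ (T-sum m (t ∘ Fin.suc)))

    p-suc : ∀ m → p (suc m) ≈ P + T (p m)
    p-suc m = +-congˡ (sym (T-sum m λ k → (T ^∘ toℕ k) P))

    T-f : T f ≈ f - P
    T-f = begin
      - x * σ f            ≈⟨ -‿distribˡ-* x (σ f) ⟨
      - (x * σ f)          ≈⟨ -‿cong (//-rightDividesʳ f (x * σ f)) ⟨
      - (x * σ f + f - f)  ≈⟨ -‿cong (+-congʳ xσf+f≈P) ⟩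
      - (P - f)            ≈⟨ -‿+-comm P (- f) ⟨
      - P - - f            ≈⟨ +-congˡ (-‿involutive f) ⟩
      - P + f              ≈⟨ +-comm _ _ ⟩
      f - P                ∎

    T-s : ∀ k → T (s k) ≈ s (suc k)
    T-s k = begin
      T (f - p k)            ≈⟨ T-homo-+ f (- p k) ⟩
      T f + T (- p k)        ≈⟨ +-cong T-f (trans (*-congˡ (-‿homo (p k))) (sym (-‿distribʳ-* (- x) _))) ⟩
      f - P - T (p k)        ≈⟨ +-assoc _ _ _ ⟩
      f + (- P - T (p k))    ≈⟨ +-congˡ (-‿+-comm P (T (p k))) ⟩
      f - (P + T (p k))      ≈⟨ +-congˡ (-‿cong (p-suc k)) ⟨
      f - p (suc k)          ∎

    -- A monomial of degree j has j factors tᵢ, and the j factors -x turn each σ tᵢ into T tᵢ. The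
    -- sequences are arbitrary because the recursion of `h` passes to shifted ones.
    σ-h : ∀ {t t′} → (∀ i → T (t i) ≈ t′ i) → ∀ m j → (- x) ^ j * σ (h t m j) ≈ h t′ m j
    σ-h Tt m       zero    = trans (*-identityˡ _) 1#-homo
    σ-h Tt zero    (suc j) = trans (*-congˡ 0#-homo) (zeroʳ _)
    σ-h {t} {t′} Tt (suc m) (suc j) = begin
      - x * (- x) ^ j * σ (t 0 * h t (suc m) j + h (t ∘ suc) m (suc j))
        ≈⟨ *-congˡ (trans (+-homo _ _) (+-congʳ (*-homo _ _))) ⟩
      - x * (- x) ^ j * (σ (t 0) * σ (h t (suc m) j) + σ (h (t ∘ suc) m (suc j)))
        ≈⟨ solve 5 (λ y z a b c → y :* z :* (a :* b :+ c) := (y :* a) :* (z :* b) :+ y :* z :* c)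
             refl _ _ _ _ _ ⟩
      T (t 0) * ((- x) ^ j * σ (h t (suc m) j)) + (- x) ^ suc j * σ (h (t ∘ suc) m (suc j))
        ≈⟨ +-cong (*-cong (Tt 0) (σ-h Tt (suc m) j)) (σ-h (Tt ∘ suc) m (suc j)) ⟩
      t′ 0 * h t′ (suc m) j + h (t′ ∘ suc) m (suc j) ∎

    σ-sign : ∀ e → σ ((- 1#) ^ e) ≈ (- 1#) ^ e
    σ-sign zero    = 1#-homo
    σ-sign (suc e) = trans (*-homo _ _) (*-cong (trans (-‿homo 1#) (-‿cong 1#-homo)) (σ-sign e))

    -- The factor xʲσ − (−1)ʲ of L.
    Φ : ℕ → Endo
    Φ j g = x ^ j * σ g + - ((- 1#) ^ j * g)

    -- Writing xʲ as (-1)ʲ(-x)ʲ pulls out the sign and leaves (-x)ʲσ - 1, to which `σ-h` applies.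
    Φ-sign : ∀ j g → Φ j g ≈ (- 1#) ^ j * ((- x) ^ j * σ g - g)
    Φ-sign j g = begin
      x ^ j * σ g - ε * g
        ≈⟨ +-cong (*-congʳ (trans (^-congˡ j (sym (trans (-1*x≈-x (- x)) (-‿involutive x))))
                                  (^-distrib-* (- 1#) (- x) j)))
                  (-‿distribʳ-* ε g) ⟩
      ε * (- x) ^ j * σ g + ε * - g
        ≈⟨ solve 4 (λ e y a b → e :* y :* a :+ e :* b := e :* (y :* a :+ b)) refl _ _ _ _ ⟩
      ε * ((- x) ^ j * σ g - g) ∎
      where
      ε = (- 1#) ^ j

    s-difference : ∀ m → s m - s 0 ≈ - p m
    s-difference m = begin
      f - p m - (f - 0#)   ≈⟨ +-congˡ (-‿cong (trans (+-congˡ -0#≈0#) (+-identityʳ f))) ⟩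
      f - p m - f          ≈⟨ solve 3 (λ a b c → a :+ b :+ c := b :+ (a :+ c)) refl f (- p m) (- f) ⟩
      - p m + (f - f)      ≈⟨ +-congˡ (-‿inverseʳ f) ⟩
      - p m + 0#           ≈⟨ +-identityʳ _ ⟩
      - p m                ∎

    -- The effect of one factor of L before the division by `p r`: `σ-h` shifts the indices and
    -- `h-difference` lowers the degree. Here e is the sign exponent collected so far.
    Φ-h : ∀ e r m → Φ (suc m) ((- 1#) ^ e * h s r (suc m)) ≈
                    p r * ((- 1#) ^ (m ℕ.+ e) * h s (suc r) m)
    Φ-h e r m = begin
      Φ (suc m) (c * h s r (suc m))
        ≈⟨ Φ-sign (suc m) _ ⟩
      - 1# * ε * ((- x) ^ suc m * σ (c * h s r (suc m)) - c * h s r (suc m))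
        ≈⟨ *-congˡ (+-cong (*-congˡ (trans (*-homo _ _) (*-congʳ (σ-sign e)))) (-‿distribʳ-* c _)) ⟩
      - 1# * ε * ((- x) ^ suc m * (c * σ (h s r (suc m))) + c * - h s r (suc m))
        ≈⟨ solve 6 (λ i ε y c a b → i :* ε :* (y :* (c :* a) :+ c :* b)
             := i :* (ε :* c :* (y :* a :+ b))) refl _ _ _ _ _ _ ⟩
      - 1# * (ε * c * ((- x) ^ suc m * σ (h s r (suc m)) - h s r (suc m)))
        ≈⟨ *-congˡ (*-congˡ (+-congʳ (σ-h T-s r (suc m)))) ⟩
      - 1# * (ε * c * (h (s ∘ suc) r (suc m) - h s r (suc m)))
        ≈⟨ *-congˡ (*-congˡ (trans (h-difference s r m) (*-congʳ (s-difference r)))) ⟩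
      - 1# * (ε * c * (- p r * H))
        ≈⟨ solve 4 (λ i d a b → i :* (d :* (a :* b)) := (i :* a) :* (d :* b)) refl _ _ _ _ ⟩
      - 1# * - p r * (ε * c * H)
        -- The -1 split off from (-1)ᵐ⁺¹ cancels that of sᵣ - s₀ = -pᵣ, so the exponent grows by m
        -- and not by m + 1.
        ≈⟨ *-cong (trans (-1*x≈-x _) (-‿involutive _)) (*-congʳ (sym (^-homo-* (- 1#) m e))) ⟩
      p r * ((- 1#) ^ (m ℕ.+ e) * H) ∎
      where
      c = (- 1#) ^ e
      ε = (- 1#) ^ m
      H = h s (suc r) m

    Φ-cong : ∀ j {g g′} → g ≈ g′ → Φ j g ≈ Φ j g′
    Φ-cong j g≈ = +-cong (*-congˡ (⟦⟧-cong g≈)) (-‿cong (*-congˡ g≈))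

    module _ (_⁻¹ : A → A) (p⁻¹ : ∀ m → p (suc m) * p (suc m) ⁻¹ ≈ 1#) where

      private
        factor : ℕ → ℕ → Endo
        factor r j = (p r ⁻¹ *_) ∘′ Φ j

      -- Induction on the r rightmost factors, which bring fⁿ from degree n = r + m down to degree
      -- m. The index is a function j because `applyUpTo` composes with `suc` at each step, while
      -- `suc r ∸ suc i` computes to `r ∸ i`.
      descent : ∀ r m n (j : ℕ → ℕ) → (∀ i → j i ≡ i ℕ.+ m) → n ≡ r ℕ.+ m →
        foldr _∘′_ id (applyUpTo (λ i → factor (r ∸ i) (suc (j i))) r) (f ^ n) ≈
        (- 1#) ^ consecutiveSum r m * h s (suc r) m
      -- With no factor applied, fⁿ is hₙ in the single variable s₀ = f - p₀, where p₀ is the empty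
      -- sum.
      descent zero m n j j≡ ≡.refl = sym (trans (*-identityˡ _) (trans (h-single s m)
        (^-congˡ m (trans (+-congˡ -0#≈0#) (+-identityʳ f)))))
      descent (suc r) m n j j≡ n≡ with j 0 | j≡ 0
      ... | _ | ≡.refl = begin
        p (suc r) ⁻¹ * Φ (suc m) _
          ≈⟨ *-congˡ (Φ-cong (suc m) (descent r (suc m) n (j ∘ suc)
               (λ i → ≡.trans (j≡ (suc i)) (≡.sym (ℕ.+-suc i m)))
               (≡.trans n≡ (≡.sym (ℕ.+-suc r m))))) ⟩
        p (suc r) ⁻¹ * Φ (suc m) ((- 1#) ^ consecutiveSum r (suc m) * h s (suc r) (suc m))
          ≈⟨ *-congˡ (Φ-h (consecutiveSum r (suc m)) (suc r) m) ⟩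
        p (suc r) ⁻¹ * (p (suc r) * H)    ≈⟨ *-assoc _ _ _ ⟨
        p (suc r) ⁻¹ * p (suc r) * H      ≈⟨ *-congʳ (trans (*-comm _ _) (p⁻¹ r)) ⟩
        1# * H                            ≈⟨ *-identityˡ H ⟩
        H                                 ∎
        where H = (- 1#) ^ consecutiveSum (suc r) m * h s (suc (suc r)) m

      descent-power : ∀ n →
        foldr _∘′_ id (applyUpTo (λ i → factor (n ∸ i) (suc i)) n) (f ^ n) ≈
        (- 1#) ^ ((n ℕ.* (n ∸ 1)) / 2)
      descent-power n = trans
        (descent n 0 n id (λ i → ≡.sym (ℕ.+-identityʳ i)) (≡.sym (ℕ.+-identityʳ n)))
        -- In degree 0 the polynomial is 1 and only the sign survives.
        (trans (*-identityʳ _) (^-congʳ (- 1#) (consecutiveSum-0 n)))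

-- Inverses of real numbers.

module RealInverses (em : ExcludedMiddle 0ℓ) where

  open RealLemmas

  BoundedAway : ℝ → ℚ → ℕ → Set
  BoundedAway a δ N = ∀ n → N ≤ n → δ ℚ.≤ ∣ seq a n ∣

  private
    split : ∀ a b → (a ℚ.- b) ℚ.+ b ≡ a
    split = solve 2 (λ a b → (a :- b) :+ b := a) ≡.refl
      where open +-*-Solver

    minus-0 : ∀ a → a ℚ.- 0ℚ ≡ a
    minus-0 = ℚ.+-identityʳ

  -- Take N beyond which terms differ by less than ε/2. If some term beyond N has absolute value at
  -- least ε, all terms there have at least ε/2, so a sequence not bounded away from 0 tends to 0.
  -- Excluded middle turns this contrapositive into a witness.
  ≉0⇒boundedAway : ∀ a → ¬ a ≈ℝ fromℚ 0ℚ → ∃ λ δ → 0ℚ ℚ.< δ × ∃ (BoundedAway a δ)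
  ≉0⇒boundedAway a a≉0 = decidable-stable em λ ¬away → a≉0 λ ε ε>0 →
    let N , close = cauchy a (½ ℚ.* ε) (half>0 ε>0) in
    N , λ n N≤n → decidable-stable (∣ seq a n ℚ.- 0ℚ ∣ ℚ.<? ε) λ aₙ≮ε →
      ¬away (½ ℚ.* ε , half>0 ε>0 , N , λ m N≤m → ℚ.≮⇒≥ λ aₘ< →
        aₙ≮ε (≡.subst (λ z → ∣ z ∣ ℚ.< ε)
          (≡.trans (split (seq a n) (seq a m)) (≡.sym (minus-0 (seq a n))))
          (+-small (seq a n ℚ.- seq a m) (seq a m) (close n m N≤n N≤m) aₘ<)))

  private
    0<⇒≢0 : ∀ {δ p} → 0ℚ ℚ.< δ → δ ℚ.≤ ∣ p ∣ → p ≡.≢ 0ℚ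
    0<⇒≢0 δ>0 δ≤ ≡.refl = ℚ.<-irrefl ≡.refl (ℚ.<-≤-trans δ>0 δ≤)

    -- Since (u - v)pr = r - p and δ² ≤ |pr|, the tolerance εδ² for p and r suffices.
    reciprocals-close : ∀ {δ ε} → 0ℚ ℚ.< δ → ∀ p r u v → p ℚ.* u ≡ 1ℚ → r ℚ.* v ≡ 1ℚ →
      δ ℚ.≤ ∣ p ∣ → δ ℚ.≤ ∣ r ∣ → ∣ p ℚ.- r ∣ ℚ.< ε ℚ.* (δ ℚ.* δ) → ∣ u ℚ.- v ∣ ℚ.< ε
    reciprocals-close {δ} {ε} δ>0 p r u v pu rv δ≤p δ≤r p-r< =
      ℚ.*-cancelʳ-<-nonNeg (δ ℚ.* δ) (begin-strict
        ∣ u ℚ.- v ∣ ℚ.* (δ ℚ.* δ)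
          ≤⟨ ℚ.*-monoˡ-≤-nonNeg ∣ u ℚ.- v ∣ δδ≤ ⟩
        ∣ u ℚ.- v ∣ ℚ.* (∣ p ∣ ℚ.* ∣ r ∣)
          ≡⟨ ≡.cong (∣ u ℚ.- v ∣ ℚ.*_) (ℚ.∣p*q∣≡∣p∣*∣q∣ p r) ⟨
        ∣ u ℚ.- v ∣ ℚ.* ∣ p ℚ.* r ∣
          ≡⟨ ℚ.∣p*q∣≡∣p∣*∣q∣ (u ℚ.- v) (p ℚ.* r) ⟨
        ∣ (u ℚ.- v) ℚ.* (p ℚ.* r) ∣
          ≡⟨ ≡.cong ∣_∣ (solve 4 (λ p r u v → (u :- v) :* (p :* r) := (p :* u) :* r :- (r :* v) :* p)
               ≡.refl p r u v) ⟩
        ∣ (p ℚ.* u) ℚ.* r ℚ.- (r ℚ.* v) ℚ.* p ∣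
          ≡⟨ ≡.cong₂ (λ y z → ∣ y ℚ.* r ℚ.- z ℚ.* p ∣) pu rv ⟩
        ∣ 1ℚ ℚ.* r ℚ.- 1ℚ ℚ.* p ∣
          ≡⟨ ≡.cong₂ (λ y z → ∣ y ℚ.- z ∣) (ℚ.*-identityˡ r) (ℚ.*-identityˡ p) ⟩
        ∣ r ℚ.- p ∣
          ≡⟨ ∣∣-swap r p ⟩
        ∣ p ℚ.- r ∣
          <⟨ p-r< ⟩
        ε ℚ.* (δ ℚ.* δ) ∎)
      where
      open ℚ.≤-Reasoning
      open +-*-Solver
      instance
        δ-pos  = positive δ>0
        δ-nn   = ℚ.pos⇒nonNeg δ
        δδ-pos = ℚ.pos*pos⇒pos δ δ
        δδ-nn  = ℚ.pos⇒nonNeg (δ ℚ.* δ)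
        p-nn   = ℚ.∣-∣-nonNeg p
        uv-nn  = ℚ.∣-∣-nonNeg (u ℚ.- v)
      δδ≤ : δ ℚ.* δ ℚ.≤ ∣ p ∣ ℚ.* ∣ r ∣
      δδ≤ = ℚ.≤-trans (ℚ.*-monoʳ-≤-nonNeg δ δ≤p) (ℚ.*-monoˡ-≤-nonNeg ∣ p ∣ δ≤r)

  boundedAway⇒invertible : ∀ a {δ N} → 0ℚ ℚ.< δ → BoundedAway a δ N →
                           ∃ λ b → (a *ℝ b) ≈ℝ fromℚ 1ℚ
  boundedAway⇒invertible a {δ} {N} δ>0 away = b , λ ε ε>0 → N , λ n N≤n → ∣∣-self
    (≡.trans (≡.cong (λ m → seq a m ℚ.* proj₁ (recip n)) (≡.sym (ℕ.m≥n⇒m⊔n≡m N≤n)))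
      (proj₂ (recip n))) ε>0
    where
    away′ : ∀ n → δ ℚ.≤ ∣ seq a (n ℕ.⊔ N) ∣
    away′ n = away (n ℕ.⊔ N) (ℕ.m≤n⊔m n N)
    -- Terms before N may vanish. Reading the sequence at `n ⊔ N` makes every term invertible and
    -- changes nothing from N on.
    recip : ∀ n → ∃ λ r → seq a (n ℕ.⊔ N) ℚ.* r ≡ 1ℚ
    recip n = ℚ.1/_ (seq a (n ℕ.⊔ N)) , ℚ.*-inverseʳ (seq a (n ℕ.⊔ N))
      where instance nz = ℚ.≢-nonZero (0<⇒≢0 δ>0 (away′ n))
    b : ℝ
    b = record
      { seq    = λ n → proj₁ (recip n)
      ; cauchy = λ ε ε>0 →
          let M , close = cauchy a (ε ℚ.* (δ ℚ.* δ)) (scale>0 ε ε>0)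
          in M , λ m n M≤m M≤n → reciprocals-close δ>0
               (seq a (m ℕ.⊔ N)) (seq a (n ℕ.⊔ N)) (proj₁ (recip m)) (proj₁ (recip n))
               (proj₂ (recip m)) (proj₂ (recip n)) (away′ m) (away′ n)
               (close (m ℕ.⊔ N) (n ℕ.⊔ N)
                 (ℕ.≤-trans M≤m (ℕ.m≤m⊔n m N)) (ℕ.≤-trans M≤n (ℕ.m≤m⊔n n N)))
      }
      where
      scale>0 : ∀ ε → 0ℚ ℚ.< ε → 0ℚ ℚ.< ε ℚ.* (δ ℚ.* δ)
      scale>0 ε ε>0 = ℚ.positive⁻¹ (ε ℚ.* (δ ℚ.* δ))
        {{ℚ.pos*pos⇒pos ε {{positive ε>0}} (δ ℚ.* δ) {{ℚ.pos*pos⇒pos δ {{positive δ>0}} δ {{positive δ>0}}}}}}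

  ℝ-hasInverses : HasInverses ℝ-commutativeRing
  ℝ-hasInverses a a≉0 = let δ , δ>0 , N , away = ≉0⇒boundedAway a a≉0 in
    boundedAway⇒invertible a δ>0 away

  private
    0≤square : ∀ p → 0ℚ ℚ.≤ p ℚ.* p
    0≤square p = ≡.subst (0ℚ ℚ.≤_) (∣p∣²≡p² (ℚ.∣p∣≡p∨∣p∣≡-p p))
      (ℚ.nonNegative⁻¹ (∣ p ∣ ℚ.* ∣ p ∣)
        {{ℚ.nonNeg*nonNeg⇒nonNeg (∣ p ∣) {{ℚ.∣-∣-nonNeg p}} (∣ p ∣) {{ℚ.∣-∣-nonNeg p}}}})
      where
      open +-*-Solver
      ∣p∣²≡p² : ∣ p ∣ ≡ p ⊎ ∣ p ∣ ≡ ℚ.- p → ∣ p ∣ ℚ.* ∣ p ∣ ≡ p ℚ.* p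
      ∣p∣²≡p² (inj₁ eq) = ≡.cong₂ ℚ._*_ eq eq
      ∣p∣²≡p² (inj₂ eq) = ≡.trans (≡.cong₂ ℚ._*_ eq eq)
        (solve 1 (λ p → :- p :* :- p := p :* p) ≡.refl p)

  -- Rational squares are nonnegative, so |aₙ|² is at most aₙ² + bₙ², and the tolerance ε² for the
  -- sum yields ε for a.
  sum-of-squares : ∀ a b → (a *ℝ a +ℝ b *ℝ b) ≈ℝ fromℚ 0ℚ → a ≈ℝ fromℚ 0ℚ
  sum-of-squares a b s≈0 ε ε>0 =
    let N , small = s≈0 (ε ℚ.* ε) (ℚ.positive⁻¹ (ε ℚ.* ε) {{ℚ.pos*pos⇒pos ε ε}}) in
    N , λ n N≤n → ℚ.≰⇒> λ ε≤ → ℚ.<-irrefl ≡.refl (ℚ.<-≤-trans (small n N≤n)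
      (bound (seq a n) (seq b n) (≡.subst (λ z → ε ℚ.≤ ∣ z ∣) (minus-0 (seq a n)) ε≤)))
    where
    instance
      ε-pos = positive ε>0
      ε-nn  = ℚ.pos⇒nonNeg ε
    bound : ∀ p r → ε ℚ.≤ ∣ p ∣ → ε ℚ.* ε ℚ.≤ ∣ p ℚ.* p ℚ.+ r ℚ.* r ℚ.- 0ℚ ∣
    bound p r ε≤ = begin
      ε ℚ.* ε                            ≤⟨ ℚ.*-monoʳ-≤-nonNeg ε ε≤ ⟩
      ∣ p ∣ ℚ.* ε                        ≤⟨ ℚ.*-monoˡ-≤-nonNeg (∣ p ∣) {{ℚ.∣-∣-nonNeg p}} ε≤ ⟩
      ∣ p ∣ ℚ.* ∣ p ∣                    ≡⟨ ℚ.∣p*q∣≡∣p∣*∣q∣ p p ⟨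
      ∣ p ℚ.* p ∣                        ≡⟨ ℚ.0≤p⇒∣p∣≡p (0≤square p) ⟩
      p ℚ.* p                            ≡⟨ ℚ.+-identityʳ (p ℚ.* p) ⟨
      p ℚ.* p ℚ.+ 0ℚ                     ≤⟨ ℚ.+-monoʳ-≤ (p ℚ.* p) (0≤square r) ⟩
      p ℚ.* p ℚ.+ r ℚ.* r                ≡⟨ ℚ.0≤p⇒∣p∣≡p (ℚ.+-mono-≤ (0≤square p) (0≤square r)) ⟨
      ∣ p ℚ.* p ℚ.+ r ℚ.* r ∣            ≡⟨ ≡.cong ∣_∣ (minus-0 (p ℚ.* p ℚ.+ r ℚ.* r)) ⟨
      ∣ p ℚ.* p ℚ.+ r ℚ.* r ℚ.- 0ℚ ∣     ∎
      where open ℚ.≤-Reasoning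

-- Inverses of complex numbers.

module AdjoinIInverses (R : CommutativeRing 0ℓ 0ℓ) where

  open CommutativeRing R
  open RingProperties ring using (-‿distribʳ-*; -‿involutive)
  open SemiringSolver commutativeSemiring using (solve; _:+_; _:*_; _:=_)
  module R[i] = CommutativeRing (AdjoinI.commutativeRing R)

  -- The inverse is the conjugate a - bi times the inverse t of the norm.
  conjugate-inverse : ∀ a b t → (a * a + b * b) * t ≈ 1# →
                      (a , b) R[i].* (a * t , - (b * t)) R[i].≈ R[i].1#
  conjugate-inverse a b t norm*t≈1 =
      trans (+-congˡ (trans (-‿cong (sym (-‿distribʳ-* b (b * t)))) (-‿involutive _)))
        (trans (solve 3 (λ a b t → a :* (a :* t) :+ b :* (b :* t) := (a :* a :+ b :* b) :* t)
          refl a b t) norm*t≈1)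
    , trans (+-cong (sym (-‿distribʳ-* a (b * t)))
        (solve 3 (λ a b t → b :* (a :* t) := a :* (b :* t)) refl a b t))
      (-‿inverseˡ _)

ℂ-hasInverses : ExcludedMiddle 0ℓ → HasInverses ℂ-commutativeRing
ℂ-hasInverses em (a , b) ab≉0 =
  let t , norm*t≈1 = ℝ-hasInverses (a *ℝ a +ℝ b *ℝ b) λ s≈0 →
        ab≉0 (sum-of-squares a b s≈0 , sum-of-squares b a (swap s≈0))
  in (a *ℝ t , ≈ℝ.- (b *ℝ t)) , conjugate-inverse a b t norm*t≈1
  where
  open RealInverses em
  open AdjoinIInverses ℝ-commutativeRing
  module ≈ℝ = CommutativeRing ℝ-commutativeRing
  swap : (a *ℝ a +ℝ b *ℝ b) ≈ℝ fromℚ 0ℚ → (b *ℝ b +ℝ a *ℝ a) ≈ℝ fromℚ 0ℚ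
  swap = ≈ℝ.trans {b *ℝ b +ℝ a *ℝ a} {a *ℝ a +ℝ b *ℝ b} {fromℚ 0ℚ} (≈ℝ.+-comm (b *ℝ b) (a *ℝ a))

-- At K = ℂ conversion checking of two equations _≈ᴸ_ unfolds them down to Cauchy
-- sequences of rationals and is infeasible. With the operations as parameters of
-- a record they are compared one at a time instead.
record PowerFormula {E : Set₁} {Q A : Set} (NonZero : Q → Set)
  (_≈_ : A → A → Set) (_+_ _*_ : A → A → A) (-_ : A → A) (0# 1# x : A) (_^_ : A → ℕ → A)
  (σ : E → Q → A → A) (L : E → Q → A → ℕ → A → A) : Set₁ where
  field
    power-formula : ∀ em q → NonZero q → ∀ n → 1 ≤ n → ∀ P f → ¬ (P ≈ 0#) →
                    ((x * σ em q f) + f) ≈ P →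
                    L em q P n (f ^ n) ≈ ((- 1#) ^ ((n ℕ.* (n ∸ 1)) / 2))

open PowerFormula

-- The power formula for Laurent series over a field.

module PowersOfSolutions (em : ExcludedMiddle 0ℓ) (K : CommutativeRing 0ℓ 0ℓ) (inv : HasInverses K)
  (q : CommutativeRing.Carrier K) (q≉0 : ¬ CommutativeRing._≈_ K q (CommutativeRing.0# K)) where

  open LaurentSeries K
  open QDifference em K q
  open LeadingTerms em K inv using (leading; leads⇒invertible)
  open QDifferenceProperties em K inv q q≉0
  open LaurentRing K using (laurentRing)
  open Reciprocal em laurentRawRing using (_⁻¹)

  σ-isRingHomomorphism : IsRingHomomorphism laurentRawRing laurentRawRing σ
  σ-isRingHomomorphism = record
    { isSemiringHomomorphism = record
      { isNearSemiringHomomorphism = record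
        { +-isMonoidHomomorphism = record
          { isMagmaHomomorphism = record
            { isRelHomomorphism = record { cong = λ {f} {g} → σ-cong {f} {g} }
            ; homo = σ-homo-+
            }
          ; ε-homo = σ-homo-0
          }
        ; *-homo = σ-homo-*
        }
      ; 1#-homo = σ-homo-1
      }
    ; -‿homo = σ-homo-neg
    }

  power-L : ∀ n P f → ¬ P ≈ᴸ 0ᴸ → x *ᴸ σ f +ᴸ f ≈ᴸ P →
            L P n (f ^ᴸ n) ≈ᴸ (-ᴸ 1ᴸ) ^ᴸ ((n ℕ.* (n ∸ 1)) / 2)
  power-L n P f P≉0 eq =
    Descent.descent-power laurentRing σ-isRingHomomorphism x P f eq _⁻¹
      -- As P is nonzero it has a leading term, which every `P[ P ] (suc m)` shares; each is
      -- therefore invertible and `_⁻¹` returns a true inverse.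
      (λ m → ReciprocalProperties.⁻¹-inverseʳ em laurentRawRing (P[ P ] (suc m))
        (leads⇒invertible (P[ P ] (suc m)) (P[]-leads P (proj₂ (leading P P≉0)) m)))
      n

powerFormula : (K : CommutativeRing 0ℓ 0ℓ) → (ExcludedMiddle 0ℓ → HasInverses K) →
  let module K = CommutativeRing K ; open LaurentSeries K in
  PowerFormula (λ q → ¬ q K.≈ K.0#) _≈ᴸ_ _+ᴸ_ _*ᴸ_ -ᴸ_ 0ᴸ 1ᴸ x _^ᴸ_
    (λ (em : ExcludedMiddle 0ℓ) → QDifference.σ em K) (λ em → QDifference.L em K)
powerFormula K inv .power-formula em q q≉0 n _ =
  PowersOfSolutions.power-L em K (inv em) q q≉0 n

open import Defs
open import Data.Nat.Base using (_*_)

powerFormulaℂ : PowerFormula (λ q → ¬ (q ≈ℂ 0ℂ)) _≈ᴸ_ _+ᴸ_ _*ᴸ_ -ᴸ_ 0ᴸ 1ᴸ x _^ᴸ_ σ L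
powerFormulaℂ = powerFormula ℂ-commutativeRing ℂ-hasInverses

theorem1 : (em : ExcludedMiddle 0ℓ) (q : ℂ) → ¬ (q ≈ℂ 0ℂ) →
    (n : ℕ) → 1 ≤ n → (P f : Laurent) → ¬ (P ≈ᴸ 0ᴸ) →
    x *ᴸ σ em q f +ᴸ f ≈ᴸ P →
    L em q P n (f ^ᴸ n) ≈ᴸ (-ᴸ 1ᴸ) ^ᴸ ((n * (n ∸ 1)) / 2)
theorem1 = power-formula powerFormulaℂ
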